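{- Let $b,c$ be positive integers with $g=\gcd(b,c)\ge 2$ and $\frac{b+c}{g}=4^l$ for a positive integer $l$. Then: 1. For all nonnegative integers $m,n$ with $2m+n=\frac{g(4^l-1)}{3}$ there is a perfect coloring of $D(m,n)$ with quotient matrix $\begin{pmatrix} c-g & b\\ c & b-g\end{pmatrix}$. 2. If $g$ is odd, then for $m$ with $2m=\frac{g(4^l-1)+3}{3}$ there is a perfect coloring of $D(m,0)$ with quotient matrix $\begin{pmatrix} c-g+3 & b\\ c & b-g+3\end{pmatrix}$.
   Context: The Shrikhande graph is the Cayley graph on $\mathbb{Z}_4^2$ with connection set $\{01,03,10,30,11,33\}$. For nonnegative integers $m,n$, $D(m,n)$ is the Cartesian product of $m$ copies of the Shrikhande graph and $n$ copies of $K_4$ (vertex set $(\mathbb{Z}_4^2)^m\times\mathbb{Z}_4^n$; adjacent iff differing in exactly one coordinate by an adjacency of that factor). A $2$-coloring (surjective map onto colors $\{1,2\}$) is perfect with quotient matrix $(s_{ij})$ if every vertex of color $i$ has exactly $s_{ij}$ neighbours of color $j$. -}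

module Defs where

open import Data.Nat using (ℕ; zero; suc; _+_; _*_; _∸_; _%_)
open import Data.Fin using (Fin; toℕ)
open import Data.Fin.Properties using (_≟_)
open import Data.Bool using (Bool; true; false; _∧_; _∨_; not)
open import Data.Product using (_×_; _,_; ∃)
open import Data.List using (List; []; _∷_; length; filterᵇ; allFin; cartesianProduct; concatMap; map)
open import Data.Vec using (Vec; []; _∷_)
open import Relation.Nullary.Decidable using (⌊_⌋)
open import Relation.Binary.PropositionalEquality using (_≡_)

ℤ₄ : Set
ℤ₄ = Fin 4

diff₄ : ℤ₄ → ℤ₄ → ℕ
diff₄ x y = (toℕ y + 4 ∸ toℕ x) % 4

eqℕ : ℕ → ℕ → Bool
eqℕ m n = ⌊ m Data.Nat.≟ n ⌋

eqF : ℤ₄ → ℤ₄ → Bool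
eqF x y = ⌊ x ≟ y ⌋

SVert : Set
SVert = ℤ₄ × ℤ₄

eqS : SVert → SVert → Bool
eqS (a , b) (a' , b') = eqF a a' ∧ eqF b b'

inConn : ℕ → ℕ → Bool
inConn 0 1 = true
inConn 0 3 = true
inConn 1 0 = true
inConn 3 0 = true
inConn 1 1 = true
inConn 3 3 = true
inConn _ _ = false

adjShrikhande : SVert → SVert → Bool
adjShrikhande (a , b) (a' , b') = inConn (diff₄ a a') (diff₄ b b')

adjK4 : ℤ₄ → ℤ₄ → Bool
adjK4 x y = not (eqF x y)

eqVec : ∀ {A : Set} {k} → (A → A → Bool) → Vec A k → Vec A k → Bool
eqVec eq [] [] = true
eqVec eq (x ∷ xs) (y ∷ ys) = eq x y ∧ eqVec eq xs ys

adjPow : ∀ {A : Set} {k} → (A → A → Bool) → (A → A → Bool) → Vec A k → Vec A k → Bool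
adjPow eq adj [] [] = false
adjPow eq adj (x ∷ xs) (y ∷ ys) =
  (adj x y ∧ eqVec eq xs ys) ∨ (eq x y ∧ adjPow eq adj xs ys)

DVert : ℕ → ℕ → Set
DVert m n = Vec SVert m × Vec ℤ₄ n

adjD : ∀ {m n} → DVert m n → DVert m n → Bool
adjD (xs , us) (ys , vs) =
  (adjPow eqS adjShrikhande xs ys ∧ eqVec eqF us vs)
  ∨ (eqVec eqS xs ys ∧ adjPow eqF adjK4 us vs)

allVecs : ∀ {A : Set} (k : ℕ) → List A → List (Vec A k)
allVecs zero as = [] ∷ []
allVecs (suc k) as = concatMap (λ a → map (a ∷_) (allVecs k as)) as

allℤ₄ : List ℤ₄
allℤ₄ = allFin 4

allSVert : List SVert
allSVert = cartesianProduct allℤ₄ allℤ₄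

-- the (finite) list of all vertices of D(m,n), each exactly once
allDVert : (m n : ℕ) → List (DVert m n)
allDVert m n = cartesianProduct (allVecs m allSVert) (allVecs n allℤ₄)

-- a 2-coloring with colours Fin 2 (colour 1 ↦ 0, colour 2 ↦ 1)
Coloring : ℕ → ℕ → Set
Coloring m n = DVert m n → Fin 2

nbrsOfColor : ∀ {m n} → Coloring m n → DVert m n → Fin 2 → ℕ
nbrsOfColor {m} {n} f x j =
  length (filterᵇ (λ y → adjD x y ∧ eqFin2 (f y) j) (allDVert m n))
  where
  eqFin2 : Fin 2 → Fin 2 → Bool
  eqFin2 a b = ⌊ a ≟ b ⌋

Surjective : ∀ {m n} → Coloring m n → Set
Surjective {m} {n} f = ∀ (i : Fin 2) → ∃ λ (x : DVert m n) → f x ≡ i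

IsPerfect : ∀ {m n} → Coloring m n → (Fin 2 → Fin 2 → ℕ) → Set
IsPerfect {m} {n} f S =
  Surjective f × (∀ (x : DVert m n) (j : Fin 2) → nbrsOfColor f x j ≡ S (f x) j)

HasPerfectColoring : ℕ → ℕ → (Fin 2 → Fin 2 → ℕ) → Set
HasPerfectColoring m n S = ∃ λ (f : Coloring m n) → IsPerfect f S

mat2 : ℕ → ℕ → ℕ → ℕ → Fin 2 → Fin 2 → ℕ
mat2 a b c d Fin.zero Fin.zero = a
mat2 a b c d Fin.zero (Fin.suc Fin.zero) = b
mat2 a b c d (Fin.suc Fin.zero) Fin.zero = c
mat2 a b c d (Fin.suc Fin.zero) (Fin.suc Fin.zero) = d

{-# OPTIONS --safe #-}
module Submission where

-- Colour D(m,n) by a group G of order 4^l so that, for every vertex x, the differences f(y) − f(x)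
-- over the neighbours y of x form the multiset consisting of r copies of 0 and g copies of every
-- nonzero element (r = 0 in part 1, r = 3 in part 2). Merging c/g of the 4^l classes into colour 1
-- and the other b/g into colour 2 then gives the required quotient matrix. Adding a coordinate whose
-- value enters through a homomorphism h adds the h-images of its connection set to the differences.
--
-- Such colourings are built one factor 4 at a time, by adding g(4^(k+1) − 4^k)/3 units of "2m + n",
-- the new differences covering g times the complement of a subgroup of order 4^k in a group of order
-- 4^(k+1). There are two kinds of layers. In F₄ × F₄^k the complement of 0 × F₄^k is the disjoint
-- union of the punctured lines F₄(1,u), u ∈ F₄^k, each the image of a K₄, or half the image of a
-- Shrikhande graph via reduction mod 2. In ℤ₄² × F₄^(k−1) the complement of 2ℤ₄² × F₄^(k−1) is
-- covered by Shrikhande coordinates alone. Combining the two kinds realises all pairs (m,n). Part 2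
-- starts from a non-additive 4-colouring of D(2,0) in which every vertex has three neighbours of
-- each colour, and then uses only Shrikhande coordinates.

open import Defs
open import Data.Nat using (ℕ; zero; suc; _+_; _*_; _∸_; _⊓_; _^_; _≤_; _%_; _≤?_; z≤n; s≤s)
import Data.Nat as ℕ
open import Data.Nat.Divisibility using (_∣_; divides)
open import Data.Nat.DivMod using (_mod_; m*n%n≡0)
open import Data.Nat.GCD using (gcd; gcd[m,n]∣m; gcd[m,n]∣n)
open import Data.Nat.Properties hiding (_≟_; _≤?_)
open import Data.Nat.Tactic.RingSolver using (solve-∀)
open import Data.Fin using (Fin; suc; toℕ)
open import Data.Fin.Patterns using (0F; 1F; 2F; 3F)
open import Data.Fin.Properties using (_≟_; all?)
open import Data.Bool using (Bool; true; false; _∧_; _∨_)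
import Data.Bool.Properties as Bool
open import Data.Unit using (⊤; tt)
open import Data.Sum using (_⊎_; inj₁; inj₂; [_,_]′)
open import Data.Product using (_×_; _,_; ∃; proj₁; proj₂)
open import Data.Product.Properties using (≡-dec)
open import Data.List
  using (List; []; _∷_; [_]; _++_; length; map; filterᵇ; allFin; cartesianProduct; concatMap; concat; replicate)
open import Data.List.Properties using (length-++; length-map; ++-assoc)
open import Data.List.Relation.Unary.All using (All; []; _∷_)
open import Data.Vec as Vec using (Vec; []; _∷_)
open import Function using (_∘_; id; const)
open import Relation.Nullary.Decidable using (Dec; ⌊_⌋; yes; no; from-yes; map′)
open import Relation.Nullary.Negation using (¬_; contradiction)
open import Relation.Binary.PropositionalEquality
  using (_≡_; refl; sym; trans; cong; cong₂; subst; subst₂; module ≡-Reasoning)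
open ≡-Reasoning

private variable
  A B : Set
  k m n : ℕ

infix 4 _≋_
infixr 7 _⊛_

-- Finite sums over lists.

∑ : List A → (A → ℕ) → ℕ
∑ []       F = 0
∑ (x ∷ xs) F = F x + ∑ xs F

∑-cong : (xs : List A) {F G : A → ℕ} → (∀ x → F x ≡ G x) → ∑ xs F ≡ ∑ xs G
∑-cong []       eq = refl
∑-cong (x ∷ xs) eq = cong₂ _+_ (eq x) (∑-cong xs eq)

∑-++ : (xs ys : List A) (F : A → ℕ) → ∑ (xs ++ ys) F ≡ ∑ xs F + ∑ ys F
∑-++ []       ys F = refl
∑-++ (x ∷ xs) ys F = trans (cong (F x +_) (∑-++ xs ys F)) (sym (+-assoc (F x) _ _))

∑-map : (h : A → B) (xs : List A) (F : B → ℕ) → ∑ (map h xs) F ≡ ∑ xs (F ∘ h)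
∑-map h []       F = refl
∑-map h (x ∷ xs) F = cong (F (h x) +_) (∑-map h xs F)

∑-concatMap : (h : A → List B) (xs : List A) (F : B → ℕ) →
  ∑ (concatMap h xs) F ≡ ∑ xs (λ x → ∑ (h x) F)
∑-concatMap h []       F = refl
∑-concatMap h (x ∷ xs) F =
  trans (∑-++ (h x) (concatMap h xs) F) (cong (∑ (h x) F +_) (∑-concatMap h xs F))

∑-cartesianProduct : (xs : List A) (ys : List B) (F : A × B → ℕ) →
  ∑ (cartesianProduct xs ys) F ≡ ∑ xs (λ x → ∑ ys (λ y → F (x , y)))
∑-cartesianProduct []       ys F = refl
∑-cartesianProduct (x ∷ xs) ys F =
  trans (∑-++ (map (x ,_) ys) _ F)
        (cong₂ _+_ (∑-map (x ,_) ys F) (∑-cartesianProduct xs ys F))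

∑-zero : (xs : List A) → ∑ xs (const 0) ≡ 0
∑-zero []       = refl
∑-zero (x ∷ xs) = ∑-zero xs

∑-+ : (xs : List A) (F G : A → ℕ) → ∑ xs (λ x → F x + G x) ≡ ∑ xs F + ∑ xs G
∑-+ []       F G = refl
∑-+ (x ∷ xs) F G = trans (cong (F x + G x +_) (∑-+ xs F G)) (interchange (F x) (G x) _ _)
  where
  interchange : ∀ a b c d → a + b + (c + d) ≡ a + c + (b + d)
  interchange = solve-∀

∑-*ˡ : (c : ℕ) (xs : List A) (F : A → ℕ) → ∑ xs (λ x → c * F x) ≡ c * ∑ xs F
∑-*ˡ c []       F = sym (*-zeroʳ c)
∑-*ˡ c (x ∷ xs) F =
  trans (cong (c * F x +_) (∑-*ˡ c xs F)) (sym (*-distribˡ-+ c (F x) _))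

∑-*ʳ : (c : ℕ) (xs : List A) (F : A → ℕ) → ∑ xs (λ x → F x * c) ≡ ∑ xs F * c
∑-*ʳ c []       F = refl
∑-*ʳ c (x ∷ xs) F =
  trans (cong (F x * c +_) (∑-*ʳ c xs F)) (sym (*-distribʳ-+ c (F x) _))

∑-swap : (xs : List A) (ys : List B) (F : A → B → ℕ) →
  ∑ xs (λ x → ∑ ys (F x)) ≡ ∑ ys (λ y → ∑ xs (λ x → F x y))
∑-swap []       ys F = sym (∑-zero ys)
∑-swap (x ∷ xs) ys F =
  trans (cong (∑ ys (F x) +_) (∑-swap xs ys F)) (sym (∑-+ ys (F x) _))

_⊛_ : ℕ → List A → List A
r ⊛ xs = concat (replicate r xs)

∑-⊛ : (r : ℕ) (xs : List A) (F : A → ℕ) → ∑ (r ⊛ xs) F ≡ r * ∑ xs F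
∑-⊛ zero    xs F = refl
∑-⊛ (suc r) xs F = trans (∑-++ xs (r ⊛ xs) F) (cong (∑ xs F +_) (∑-⊛ r xs F))

length-⊛ : (r : ℕ) (xs : List A) → length (r ⊛ xs) ≡ r * length xs
length-⊛ zero    xs = refl
length-⊛ (suc r) xs = trans (length-++ xs) (cong (length xs +_) (length-⊛ r xs))

-- Lists as multisets, and indicator values.

-- Equality of multisets, tested against all weights: neighbourhoods are only ever used through
-- sums, so no permutation has to be exhibited.
_≋_ : List A → List A → Set
xs ≋ ys = ∀ F → ∑ xs F ≡ ∑ ys F

iv : Bool → ℕ
iv true  = 1
iv false = 0

iv-∧ : ∀ p q → iv (p ∧ q) ≡ iv p * iv q
iv-∧ true  q = sym (+-identityʳ (iv q))
iv-∧ false q = refl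

iv-∨ : ∀ p q → p ∧ q ≡ false → iv (p ∨ q) ≡ iv p + iv q
iv-∨ true  false _ = refl
iv-∨ false q     _ = refl

length-filterᵇ : (P : A → Bool) (xs : List A) → length (filterᵇ P xs) ≡ ∑ xs (iv ∘ P)
length-filterᵇ P []       = refl
length-filterᵇ P (x ∷ xs) with P x
... | true  = cong suc (length-filterᵇ P xs)
... | false = length-filterᵇ P xs

-- The sifting property of the Kronecker delta; it expresses that each `x` is listed exactly once.
IsEnumeration : List A → (A → A → Bool) → Set
IsEnumeration {A} xs eq = ∀ (x : A) (F : A → ℕ) → ∑ xs (λ a → iv (eq x a) * F a) ≡ F x

module _ (all : List A) (eq : A → A → Bool) (enum : IsEnumeration all eq) where

  ∑-by-count : (xs : List A) (F : A → ℕ) →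
    ∑ xs F ≡ ∑ all (λ a → ∑ xs (λ x → iv (eq x a)) * F a)
  ∑-by-count xs F = begin
    ∑ xs F                                        ≡⟨ ∑-cong xs (λ x → sym (enum x F)) ⟩
    ∑ xs (λ x → ∑ all (λ a → iv (eq x a) * F a))  ≡⟨ ∑-swap xs all _ ⟩
    ∑ all (λ a → ∑ xs (λ x → iv (eq x a) * F a))  ≡⟨ ∑-cong all (λ a → ∑-*ʳ (F a) xs _) ⟩
    ∑ all (λ a → ∑ xs (λ x → iv (eq x a)) * F a)  ∎

  -- Reduces an identity for all weights to one count per element, which evaluation can decide for
  -- concrete finite lists.
  ≋-by-count : (xs ys : List A) →
    (∀ a → ∑ xs (λ x → iv (eq x a)) ≡ ∑ ys (λ y → iv (eq y a))) → xs ≋ ys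
  ≋-by-count xs ys counts F = begin
    ∑ xs F                                        ≡⟨ ∑-by-count xs F ⟩
    ∑ all (λ a → ∑ xs (λ x → iv (eq x a)) * F a)  ≡⟨ ∑-cong all (λ a → cong (_* F a) (counts a)) ⟩
    ∑ all (λ a → ∑ ys (λ y → iv (eq y a)) * F a)  ≡⟨ ∑-by-count ys F ⟨
    ∑ ys F                                        ∎

-- Graphs, Cartesian products and powers.

-- `adj-nbrs` passes from Boolean adjacency to an explicit list of neighbours. `disjoint` excludes
-- loops, so that the `∨` in the adjacency of a product turns into a sum.
record Graph (A : Set) : Set where
  field
    all       : List A
    eq adj    : A → A → Bool
    nbrs      : A → List A
    enum      : IsEnumeration all eq
    adj-nbrs  : ∀ x F → ∑ all (λ a → iv (adj x a) * F a) ≡ ∑ (nbrs x) F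
    disjoint  : ∀ x a → adj x a ∧ eq x a ≡ false

module _ (𝒜 : Graph A) (ℬ : Graph B) where
  private
    module 𝒜 = Graph 𝒜
    module ℬ = Graph ℬ

  □-all : List (A × B)
  □-all = cartesianProduct 𝒜.all ℬ.all

  □-nbrs : A × B → List (A × B)
  □-nbrs (x , y) = map (_, y) (𝒜.nbrs x) ++ map (x ,_) (ℬ.nbrs y)

  □-eq □-adj : A × B → A × B → Bool
  □-eq  (x , y) (a , b) = 𝒜.eq x a ∧ ℬ.eq y b
  □-adj (x , y) (a , b) = (𝒜.adj x a ∧ ℬ.eq y b) ∨ (𝒜.eq x a ∧ ℬ.adj y b)

  private
    product-∑ : (P : A → Bool) (Q : B → Bool) (F : A × B → ℕ) →
      ∑ □-all (λ (a , b) → iv (P a ∧ Q b) * F (a , b)) ≡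
      ∑ 𝒜.all (λ a → iv (P a) * ∑ ℬ.all (λ b → iv (Q b) * F (a , b)))
    product-∑ P Q F = trans (∑-cartesianProduct 𝒜.all ℬ.all _) (∑-cong 𝒜.all λ a →
      trans (∑-cong ℬ.all λ b → trans (cong (_* F (a , b)) (iv-∧ (P a) (Q b)))
                                      (*-assoc (iv (P a)) (iv (Q b)) (F (a , b))))
            (∑-*ˡ (iv (P a)) ℬ.all _))

    disjoint-lemma : ∀ p q r s → p ∧ r ≡ false → (p ∧ q) ∧ (r ∧ s) ≡ false
    disjoint-lemma true  q false s refl = Bool.∧-zeroʳ q
    disjoint-lemma false q r     s e    = refl

    disjoint-lemma′ : ∀ p q r s → p ∧ r ≡ false → s ∧ q ≡ false →
      ((p ∧ q) ∨ (r ∧ s)) ∧ (r ∧ q) ≡ false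
    disjoint-lemma′ true  q     false s     refl e = Bool.∧-zeroʳ (q ∨ false)
    disjoint-lemma′ false q     false s     d e    = refl
    disjoint-lemma′ false true  true  false d e    = refl
    disjoint-lemma′ false false true  s     d e    = Bool.∧-zeroʳ s

  infixr 5 _□_

  _□_ : Graph (A × B)
  _□_ = record
    { all      = □-all
    ; eq       = □-eq
    ; adj      = □-adj
    ; nbrs     = □-nbrs
    ; enum     = λ (x , y) F → trans (product-∑ (𝒜.eq x) (ℬ.eq y) F)
                   (trans (𝒜.enum x _) (ℬ.enum y _))
    ; adj-nbrs = λ (x , y) F → begin
        ∑ □-all (λ (a , b) → iv (□-adj (x , y) (a , b)) * F (a , b))
          ≡⟨ ∑-cong □-all (λ (a , b) → trans (cong (_* F (a , b)) (iv-∨ (𝒜.adj x a ∧ ℬ.eq y b) _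
               (disjoint-lemma (𝒜.adj x a) (ℬ.eq y b) (𝒜.eq x a) (ℬ.adj y b) (𝒜.disjoint x a))))
               (*-distribʳ-+ (F (a , b)) (iv (𝒜.adj x a ∧ ℬ.eq y b)) _)) ⟩
        ∑ □-all (λ (a , b) → iv (𝒜.adj x a ∧ ℬ.eq y b) * F (a , b) + iv (𝒜.eq x a ∧ ℬ.adj y b) * F (a , b))
          ≡⟨ ∑-+ □-all _ _ ⟩
        _ ≡⟨ cong₂ _+_ (product-∑ (𝒜.adj x) (ℬ.eq y) F) (product-∑ (𝒜.eq x) (ℬ.adj y) F) ⟩
        _ ≡⟨ cong₂ _+_ (trans (𝒜.adj-nbrs x _) (∑-cong (𝒜.nbrs x) λ a → ℬ.enum y _))
                       (trans (𝒜.enum x _) (ℬ.adj-nbrs y _)) ⟩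
        ∑ (𝒜.nbrs x) (λ a → F (a , y)) + ∑ (ℬ.nbrs y) (λ b → F (x , b))
          ≡⟨ cong₂ _+_ (∑-map (_, y) (𝒜.nbrs x) F) (∑-map (x ,_) (ℬ.nbrs y) F) ⟨
        ∑ (map (_, y) (𝒜.nbrs x)) F + ∑ (map (x ,_) (ℬ.nbrs y)) F
          ≡⟨ ∑-++ (map (_, y) (𝒜.nbrs x)) _ F ⟨
        ∑ (□-nbrs (x , y)) F ∎
    ; disjoint = λ (x , y) (a , b) →
        disjoint-lemma′ (𝒜.adj x a) (ℬ.eq y b) (𝒜.eq x a) (ℬ.adj y b) (𝒜.disjoint x a) (ℬ.disjoint y b)
    }

module _ (𝒜 : Graph A) where
  private module 𝒜 = Graph 𝒜

  pow-nbrs : Vec A k → List (Vec A k)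
  pow-nbrs []       = []
  pow-nbrs (x ∷ xs) = map (_∷ xs) (𝒜.nbrs x) ++ map (x ∷_) (pow-nbrs xs)

  private
    ∑-allVecs : ∀ k (F : Vec A (suc k) → ℕ) →
      ∑ (allVecs (suc k) 𝒜.all) F ≡
      ∑ (cartesianProduct 𝒜.all (allVecs k 𝒜.all)) (λ (a , as) → F (a ∷ as))
    ∑-allVecs k F = begin
      _ ≡⟨ ∑-concatMap (λ a → map (a ∷_) (allVecs k 𝒜.all)) 𝒜.all F ⟩
      _ ≡⟨ ∑-cong 𝒜.all (λ a → ∑-map (a ∷_) (allVecs k 𝒜.all) F) ⟩
      _ ≡⟨ ∑-cartesianProduct 𝒜.all (allVecs k 𝒜.all) _ ⟨
      _ ∎

    enum : ∀ k → IsEnumeration (allVecs k 𝒜.all) (eqVec 𝒜.eq)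
    adj-nbrs : ∀ k (x : Vec A k) F →
      ∑ (allVecs k 𝒜.all) (λ a → iv (adjPow 𝒜.eq 𝒜.adj x a) * F a) ≡ ∑ (pow-nbrs x) F
    disjoint : ∀ k (x a : Vec A k) → adjPow 𝒜.eq 𝒜.adj x a ∧ eqVec 𝒜.eq x a ≡ false

  -- A nonempty vector is read as the pair of its head and tail, so the properties of `pow (suc k)`
  -- come from those of `𝒜 □ pow k`.
  pow : ∀ k → Graph (Vec A k)
  pow k = record
    { all = allVecs k 𝒜.all ; eq = eqVec 𝒜.eq ; adj = adjPow 𝒜.eq 𝒜.adj ; nbrs = pow-nbrs
    ; enum = enum k ; adj-nbrs = adj-nbrs k ; disjoint = disjoint k }

  enum zero    []       F = trans (+-identityʳ _) (+-identityʳ (F []))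
  enum (suc k) (x ∷ xs) F =
    trans (∑-allVecs k _) (Graph.enum (𝒜 □ pow k) (x , xs) (λ (a , as) → F (a ∷ as)))

  adj-nbrs zero    []       F = refl
  adj-nbrs (suc k) (x ∷ xs) F = begin
    _ ≡⟨ ∑-allVecs k _ ⟩
    _ ≡⟨ Graph.adj-nbrs (𝒜 □ pow k) (x , xs) (λ (a , as) → F (a ∷ as)) ⟩
    ∑ (map (_, xs) (𝒜.nbrs x) ++ map (x ,_) (pow-nbrs xs)) (λ (a , as) → F (a ∷ as))
      ≡⟨ ∑-++ (map (_, xs) (𝒜.nbrs x)) _ _ ⟩
    _ ≡⟨ cong₂ _+_ (trans (∑-map (_, xs) (𝒜.nbrs x) _) (sym (∑-map (_∷ xs) (𝒜.nbrs x) F)))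
                   (trans (∑-map (x ,_) (pow-nbrs xs) _) (sym (∑-map (x ∷_) (pow-nbrs xs) F))) ⟩
    _ ≡⟨ ∑-++ (map (_∷ xs) (𝒜.nbrs x)) _ F ⟨
    _ ∎

  disjoint zero    []       []       = refl
  disjoint (suc k) (x ∷ xs) (a ∷ as) = Graph.disjoint (𝒜 □ pow k) (x , xs) (a , as)

-- The field of four elements, and the graphs K₄, Shrikhande and D(m,n).

infixl 6 _⊕_ _⊞₁_ _⊞_
infixl 7 _⊗_

-- ℤ₄ is also used as the field of four elements, with 2 = ω and 3 = ω².
_⊕_ _⊗_ : ℤ₄ → ℤ₄ → ℤ₄
0F ⊕ y  = y
1F ⊕ 0F = 1F
1F ⊕ 1F = 0F
1F ⊕ 2F = 3F
1F ⊕ 3F = 2F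
2F ⊕ 0F = 2F
2F ⊕ 1F = 3F
2F ⊕ 2F = 0F
2F ⊕ 3F = 1F
3F ⊕ 0F = 3F
3F ⊕ 1F = 2F
3F ⊕ 2F = 1F
3F ⊕ 3F = 0F
0F ⊗ y  = 0F
1F ⊗ y  = y
2F ⊗ 0F = 0F
2F ⊗ 1F = 2F
2F ⊗ 2F = 3F
2F ⊗ 3F = 1F
3F ⊗ 0F = 0F
3F ⊗ 1F = 3F
3F ⊗ 2F = 1F
3F ⊗ 3F = 2F

_⊞₁_ : ℤ₄ → ℤ₄ → ℤ₄
x ⊞₁ y = (toℕ x + toℕ y) mod 4

_⊞_ : SVert → SVert → SVert
(a , b) ⊞ (c , d) = (a ⊞₁ c , b ⊞₁ d)

units : List ℤ₄
units = 1F ∷ 2F ∷ 3F ∷ []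

conn : List SVert
conn = (0F , 1F) ∷ (0F , 3F) ∷ (1F , 0F) ∷ (3F , 0F) ∷ (1F , 1F) ∷ (3F , 3F) ∷ []

enumℤ₄ : IsEnumeration allℤ₄ eqF
enumℤ₄ 0F F = trans (+-identityʳ (F 0F + 0)) (+-identityʳ (F 0F))
enumℤ₄ 1F F = trans (+-identityʳ (F 1F + 0)) (+-identityʳ (F 1F))
enumℤ₄ 2F F = trans (+-identityʳ (F 2F + 0)) (+-identityʳ (F 2F))
enumℤ₄ 3F F = trans (+-identityʳ (F 3F + 0)) (+-identityʳ (F 3F))

allS? : {P : SVert → Set} → (∀ s → Dec (P s)) → Dec (∀ s → P s)
allS? P? = map′ (λ f (a , b) → f a b) (λ f a b → f (a , b)) (all? λ a → all? λ b → P? (a , b))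

K₄ : Graph ℤ₄
K₄ = record
  { all = allℤ₄ ; eq = eqF ; adj = adjK4 ; nbrs = nbrs ; enum = enumℤ₄
  ; adj-nbrs = λ x F → trans (∑-cong allℤ₄ (λ a → cong (_* F a) (counts x a)))
                             (sym (∑-by-count allℤ₄ eqF enumℤ₄ (nbrs x) F))
  ; disjoint = from-yes (all? λ x → all? λ a → (adjK4 x a ∧ eqF x a) Bool.≟ false) }
  where
  nbrs : ℤ₄ → List ℤ₄
  nbrs x = map (_⊕ x) units

  counts : ∀ x a → iv (adjK4 x a) ≡ ∑ (nbrs x) (λ y → iv (eqF y a))
  counts = from-yes (all? λ x → all? λ a → iv (adjK4 x a) ℕ.≟ ∑ (nbrs x) (λ y → iv (eqF y a)))

enumSVert : IsEnumeration allSVert eqS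
enumSVert = Graph.enum (K₄ □ K₄)

Sh : Graph SVert
Sh = record
  { all = allSVert ; eq = eqS ; adj = adjShrikhande ; nbrs = nbrs ; enum = enumSVert
  ; adj-nbrs = λ x F → trans (∑-cong allSVert (λ a → cong (_* F a) (counts x a)))
                             (sym (∑-by-count allSVert eqS enumSVert (nbrs x) F))
  ; disjoint = from-yes (allS? λ x → allS? λ a → (adjShrikhande x a ∧ eqS x a) Bool.≟ false) }
  where
  nbrs : SVert → List SVert
  nbrs s = map (_⊞ s) conn

  counts : ∀ x a → iv (adjShrikhande x a) ≡ ∑ (nbrs x) (λ y → iv (eqS y a))
  counts = from-yes (allS? λ x → allS? λ a →
    iv (adjShrikhande x a) ℕ.≟ ∑ (nbrs x) (λ y → iv (eqS y a)))

Doob : ∀ m n → Graph (DVert m n)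
Doob m n = pow Sh m □ pow K₄ n

neighbours : DVert m n → List (DVert m n)
neighbours {m} {n} = Graph.nbrs (Doob m n)

nbrsOfColor-∑ : (f : Coloring m n) (x : DVert m n) (j : Fin 2) →
  nbrsOfColor f x j ≡ ∑ (neighbours x) (λ y → iv ⌊ f y ≟ j ⌋)
nbrsOfColor-∑ {m} {n} f x j = begin
  nbrsOfColor f x j                                        ≡⟨ length-filterᵇ _ (allDVert m n) ⟩
  ∑ (allDVert m n) (λ y → iv (adjD x y ∧ ⌊ f y ≟ j ⌋))     ≡⟨ ∑-cong (allDVert m n) (λ y → iv-∧ (adjD x y) _) ⟩
  ∑ (allDVert m n) (λ y → iv (adjD x y) * iv ⌊ f y ≟ j ⌋)  ≡⟨ Graph.adj-nbrs (Doob m n) x _ ⟩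
  ∑ (neighbours x) (λ y → iv ⌊ f y ≟ j ⌋)                  ∎

-- Finite abelian groups.

record FiniteAbelianGroup : Set₁ where
  no-eta-equality
  infixl 7 _∙_
  field
    Carrier   : Set
    _∙_       : Carrier → Carrier → Carrier
    ε         : Carrier
    assoc     : ∀ a b c → (a ∙ b) ∙ c ≡ a ∙ (b ∙ c)
    comm      : ∀ a b → a ∙ b ≡ b ∙ a
    identityˡ : ∀ a → ε ∙ a ≡ a
    nonzero   : List Carrier

  elements : List Carrier
  elements = ε ∷ nonzero

  -- Takes the place of inverses.
  field
    translate : ∀ a → map (_∙ a) elements ≋ elements

translation? : (_∙_ : ℤ₄ → ℤ₄ → ℤ₄) →
  Dec (∀ a b → ∑ (map (_∙ a) allℤ₄) (λ d → iv (eqF d b)) ≡ ∑ allℤ₄ (λ d → iv (eqF d b)))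
translation? _∙_ = all? λ a → all? λ b →
  ∑ (map (_∙ a) allℤ₄) (λ d → iv (eqF d b)) ℕ.≟ ∑ allℤ₄ (λ d → iv (eqF d b))

module _ where
  open FiniteAbelianGroup

  F₄⁺ : FiniteAbelianGroup
  F₄⁺ .Carrier   = ℤ₄
  F₄⁺ ._∙_       = _⊕_
  F₄⁺ .ε         = 0F
  F₄⁺ .assoc     = from-yes (all? λ a → all? λ b → all? λ c → a ⊕ b ⊕ c ≟ a ⊕ (b ⊕ c))
  F₄⁺ .comm      = from-yes (all? λ a → all? λ b → a ⊕ b ≟ b ⊕ a)
  F₄⁺ .identityˡ = λ a → refl
  F₄⁺ .nonzero   = units
  F₄⁺ .translate = λ a → ≋-by-count allℤ₄ eqF enumℤ₄ (map (_⊕ a) allℤ₄) allℤ₄ (from-yes (translation? _⊕_) a)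

  Z₄ : FiniteAbelianGroup
  Z₄ .Carrier   = ℤ₄
  Z₄ ._∙_       = _⊞₁_
  Z₄ .ε         = 0F
  Z₄ .assoc     = from-yes (all? λ a → all? λ b → all? λ c → a ⊞₁ b ⊞₁ c ≟ a ⊞₁ (b ⊞₁ c))
  Z₄ .comm      = from-yes (all? λ a → all? λ b → a ⊞₁ b ≟ b ⊞₁ a)
  Z₄ .identityˡ = from-yes (all? λ a → 0F ⊞₁ a ≟ a)
  Z₄ .nonzero   = units
  Z₄ .translate = λ a → ≋-by-count allℤ₄ eqF enumℤ₄ (map (_⊞₁ a) allℤ₄) allℤ₄ (from-yes (translation? _⊞₁_) a)

  trivial : FiniteAbelianGroup
  trivial .Carrier   = ⊤
  trivial ._∙_       = λ _ _ → tt
  trivial .ε         = tt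
  trivial .assoc     = λ _ _ _ → refl
  trivial .comm      = λ _ _ → refl
  trivial .identityˡ = λ _ → refl
  trivial .nonzero   = []
  trivial .translate = λ _ _ → refl

  infixr 5 _⊠_

  _⊠_ : FiniteAbelianGroup → FiniteAbelianGroup → FiniteAbelianGroup
  (G ⊠ H) .Carrier   = Carrier G × Carrier H
  (G ⊠ H) ._∙_       = λ (a , b) (c , d) → G ._∙_ a c , H ._∙_ b d
  (G ⊠ H) .ε         = G .ε , H .ε
  (G ⊠ H) .assoc     = λ (a , a′) (b , b′) (c , c′) → cong₂ _,_ (G .assoc a b c) (H .assoc a′ b′ c′)
  (G ⊠ H) .comm      = λ (a , a′) (b , b′) → cong₂ _,_ (G .comm a b) (H .comm a′ b′)
  (G ⊠ H) .identityˡ = λ (a , a′) → cong₂ _,_ (G .identityˡ a) (H .identityˡ a′)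
  -- The order is chosen so that `elements (G ⊠ H)` computes to the Cartesian product of
  -- `elements G` and `elements H`.
  (G ⊠ H) .nonzero   = map (G .ε ,_) (H .nonzero) ++ cartesianProduct (G .nonzero) (elements H)
  (G ⊠ H) .translate = λ (a , b) F → begin
    ∑ (map _ (cartesianProduct G.elements H.elements)) F
      ≡⟨ ∑-map _ (cartesianProduct G.elements H.elements) F ⟩
    _ ≡⟨ ∑-cartesianProduct G.elements H.elements _ ⟩
    ∑ G.elements (λ c → ∑ H.elements (λ d → F (c G.∙ a , d H.∙ b)))
      ≡⟨ ∑-cong G.elements (λ c → trans (sym (∑-map (H._∙ b) H.elements _)) (H.translate b _)) ⟩
    ∑ G.elements (λ c → ∑ H.elements (λ d → F (c G.∙ a , d)))
      ≡⟨ trans (sym (∑-map (G._∙ a) G.elements _)) (G.translate a _) ⟩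
    ∑ G.elements (λ c → ∑ H.elements (λ d → F (c , d)))
      ≡⟨ ∑-cartesianProduct G.elements H.elements F ⟨
    ∑ (cartesianProduct G.elements H.elements) F ∎
    where
    module G = FiniteAbelianGroup G
    module H = FiniteAbelianGroup H

open FiniteAbelianGroup using (Carrier; elements; nonzero)

private variable
  G H K : FiniteAbelianGroup

F₄^ : ℕ → FiniteAbelianGroup
F₄^ zero    = trivial
F₄^ (suc k) = F₄⁺ ⊠ F₄^ k

-- Colourings with a constant multiset of differences, and homomorphisms.

-- `L` is the multiset of differences f(y) - f(x) over the neighbours y of x, the same for all x.
-- Writing the neighbouring colours as `d ∙ colour x` avoids subtraction in the group.
record DiffColoring (G : FiniteAbelianGroup) (m n : ℕ) (L : List (Carrier G)) : Set where
  open FiniteAbelianGroup G using (_∙_)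
  field
    colour      : DVert m n → Carrier G
    differences : ∀ x W → ∑ (neighbours x) (W ∘ colour) ≡ ∑ L (λ d → W (d ∙ colour x))

record _⟶_ (G H : FiniteAbelianGroup) : Set where
  private
    module G = FiniteAbelianGroup G
    module H = FiniteAbelianGroup H
  field
    ⟦_⟧  : Carrier G → Carrier H
    homo : ∀ a b → ⟦ a G.∙ b ⟧ ≡ ⟦ a ⟧ H.∙ ⟦ b ⟧

open DiffColoring
open _⟶_

_∘ʰ_ : H ⟶ K → G ⟶ H → G ⟶ K
p ∘ʰ q = record { ⟦_⟧ = ⟦ p ⟧ ∘ ⟦ q ⟧
                ; homo = λ a b → trans (cong ⟦ p ⟧ (homo q a b)) (homo p (⟦ q ⟧ a) (⟦ q ⟧ b)) }

⟨_,_⟩ : G ⟶ H → G ⟶ K → G ⟶ (H ⊠ K)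
⟨ p , q ⟩ = record { ⟦_⟧ = λ a → ⟦ p ⟧ a , ⟦ q ⟧ a ; homo = λ a b → cong₂ _,_ (homo p a b) (homo q a b) }

≋-resp : {L L′ : List (Carrier G)} → L ≋ L′ → DiffColoring G m n L → DiffColoring G m n L′
≋-resp L≋L′ f = record
  { colour = colour f ; differences = λ x W → trans (differences f x W) (L≋L′ _) }

push : {L : List (Carrier G)} (h : G ⟶ H) → DiffColoring G m n L → DiffColoring H m n (map ⟦ h ⟧ L)
push {H = H} {L = L} h f = record
  { colour = ⟦ h ⟧ ∘ colour f
  ; differences = λ x W → begin
      ∑ (neighbours x) (W ∘ ⟦ h ⟧ ∘ colour f)          ≡⟨ differences f x (W ∘ ⟦ h ⟧) ⟩
      _                                                ≡⟨ ∑-cong L (λ d → cong W (homo h d (colour f x))) ⟩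
      ∑ L (λ d → W (⟦ h ⟧ d ∙ ⟦ h ⟧ (colour f x)))     ≡⟨ ∑-map ⟦ h ⟧ L _ ⟨
      ∑ (map ⟦ h ⟧ L) (λ d → W (d ∙ ⟦ h ⟧ (colour f x))) ∎ }
  where open FiniteAbelianGroup H using (_∙_)

-- Adding one coordinate to a colouring.

∑-neighbours : (xs : Vec SVert m) (us : Vec ℤ₄ n) (F : DVert m n → ℕ) →
  ∑ (neighbours (xs , us)) F ≡
  ∑ (pow-nbrs Sh xs) (λ ys → F (ys , us)) + ∑ (pow-nbrs K₄ us) (λ vs → F (xs , vs))
∑-neighbours xs us F = trans (∑-++ (map (_, us) (pow-nbrs Sh xs)) _ F)
  (cong₂ _+_ (∑-map (_, us) (pow-nbrs Sh xs) F) (∑-map (xs ,_) (pow-nbrs K₄ us) F))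

∑-pow-nbrs : (𝒢 : Graph A) (x : A) (xs : Vec A k) (F : Vec A (suc k) → ℕ) →
  ∑ (pow-nbrs 𝒢 (x ∷ xs)) F ≡
  ∑ (Graph.nbrs 𝒢 x) (λ a → F (a ∷ xs)) + ∑ (pow-nbrs 𝒢 xs) (λ as → F (x ∷ as))
∑-pow-nbrs 𝒢 x xs F = trans (∑-++ (map (_∷ xs) (Graph.nbrs 𝒢 x)) _ F)
  (cong₂ _+_ (∑-map (_∷ xs) (Graph.nbrs 𝒢 x) F) (∑-map (x ∷_) (pow-nbrs 𝒢 xs) F))

∑-neighbours-Sh : (s : SVert) (xs : Vec SVert m) (us : Vec ℤ₄ n) (F : DVert (suc m) n → ℕ) →
  ∑ (neighbours (s ∷ xs , us)) F ≡
  ∑ (map (_⊞ s) conn) (λ a → F (a ∷ xs , us)) + ∑ (neighbours (xs , us)) (λ (ys , vs) → F (s ∷ ys , vs))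
∑-neighbours-Sh s xs us F = begin
  _ ≡⟨ ∑-neighbours (s ∷ xs) us F ⟩
  _ ≡⟨ cong (_+ ∑ (pow-nbrs K₄ us) (λ vs → F (s ∷ xs , vs))) (∑-pow-nbrs Sh s xs (λ ys → F (ys , us))) ⟩
  _ ≡⟨ +-assoc (∑ (map (_⊞ s) conn) (λ a → F (a ∷ xs , us))) _ _ ⟩
  _ ≡⟨ cong (∑ (map (_⊞ s) conn) (λ a → F (a ∷ xs , us)) +_) (∑-neighbours xs us (λ (ys , vs) → F (s ∷ ys , vs))) ⟨
  _ ∎

∑-neighbours-K₄ : (xs : Vec SVert m) (u : ℤ₄) (us : Vec ℤ₄ n) (F : DVert m (suc n) → ℕ) →
  ∑ (neighbours (xs , u ∷ us)) F ≡
  ∑ (map (_⊕ u) units) (λ a → F (xs , a ∷ us)) + ∑ (neighbours (xs , us)) (λ (ys , vs) → F (ys , u ∷ vs))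
∑-neighbours-K₄ xs u us F = begin
  _ ≡⟨ ∑-neighbours xs (u ∷ us) F ⟩
  _ ≡⟨ cong (S +_) (∑-pow-nbrs K₄ u us (λ vs → F (xs , vs))) ⟩
  _ ≡⟨ rotate S T _ ⟩
  _ ≡⟨ cong (T +_) (∑-neighbours xs us (λ (ys , vs) → F (ys , u ∷ vs))) ⟨
  _ ∎
  where
  S = ∑ (pow-nbrs Sh xs) (λ ys → F (ys , u ∷ us))
  T = ∑ (map (_⊕ u) units) (λ a → F (xs , a ∷ us))

  rotate : ∀ a b c → a + (b + c) ≡ b + (a + c)
  rotate = solve-∀

Z₄² : FiniteAbelianGroup
Z₄² = Z₄ ⊠ Z₄

module _ {L : List (Carrier G)} where
  open FiniteAbelianGroup G using (_∙_; assoc; comm)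

  private
    swap-left : ∀ a b c → a ∙ (b ∙ c) ≡ b ∙ (a ∙ c)
    swap-left a b c = trans (sym (assoc a b c)) (trans (cong (_∙ c) (comm a b)) (assoc b a c))

    -- The new colour is `⟦ h ⟧ s ∙ colour f x`. A move in the new coordinate changes only the first
    -- factor, any other move only the second; associativity and commutativity bring both changes to
    -- the front.
    extend : (h : H ⟶ G) (f : DiffColoring G m n L) (δs : List (Carrier H)) →
      let open FiniteAbelianGroup H renaming (_∙_ to _∙′_) in ∀ s x W →
      ∑ (map (_∙′ s) δs) (λ a → W (⟦ h ⟧ a ∙ colour f x)) +
      ∑ (neighbours x) (λ y → W (⟦ h ⟧ s ∙ colour f y)) ≡
      ∑ (map ⟦ h ⟧ δs ++ L) (λ d → W (d ∙ (⟦ h ⟧ s ∙ colour f x)))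
    extend {H = H} h f δs s x W = begin
      _ ≡⟨ cong₂ _+_ (∑-map (_∙′ s) δs _) (differences f x (λ a → W (⟦ h ⟧ s ∙ a))) ⟩
      ∑ δs (λ δ → W (⟦ h ⟧ (δ ∙′ s) ∙ colour f x)) + ∑ L (λ d → W (⟦ h ⟧ s ∙ (d ∙ colour f x)))
        ≡⟨ cong₂ _+_ (∑-cong δs λ δ → cong W (trans (cong (_∙ colour f x) (homo h δ s)) (assoc _ _ _)))
                     (∑-cong L λ d → cong W (swap-left (⟦ h ⟧ s) d (colour f x))) ⟩
      ∑ δs (λ δ → W (⟦ h ⟧ δ ∙ (⟦ h ⟧ s ∙ colour f x))) + ∑ L (λ d → W (d ∙ (⟦ h ⟧ s ∙ colour f x)))
        ≡⟨ cong (_+ ∑ L (λ d → W (d ∙ (⟦ h ⟧ s ∙ colour f x)))) (∑-map ⟦ h ⟧ δs _) ⟨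
      ∑ (map ⟦ h ⟧ δs) _ + ∑ L (λ d → W (d ∙ (⟦ h ⟧ s ∙ colour f x))) ≡⟨ ∑-++ (map ⟦ h ⟧ δs) L _ ⟨
      _ ∎
      where open FiniteAbelianGroup H renaming (_∙_ to _∙′_) using ()

  addSh : (h : Z₄² ⟶ G) → DiffColoring G m n L → DiffColoring G (suc m) n (map ⟦ h ⟧ conn ++ L)
  addSh {m} {n} h f = record
    { colour = c
    ; differences = λ { (s ∷ xs , us) W →
        trans (∑-neighbours-Sh s xs us (W ∘ c)) (extend h f conn s (xs , us) W) } }
    where
    c : DVert (suc m) n → Carrier G
    c (s ∷ xs , us) = ⟦ h ⟧ s ∙ colour f (xs , us)

  addK₄ : (h : F₄⁺ ⟶ G) → DiffColoring G m n L → DiffColoring G m (suc n) (map ⟦ h ⟧ units ++ L)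
  addK₄ {m} {n} h f = record
    { colour = c
    ; differences = λ { (xs , u ∷ us) W →
        trans (∑-neighbours-K₄ xs u us (W ∘ c)) (extend h f units u (xs , us) W) } }
    where
    c : DVert m (suc n) → Carrier G
    c (xs , u ∷ us) = ⟦ h ⟧ u ∙ colour f (xs , us)

-- Uniform colourings.

module _ (G : FiniteAbelianGroup) where
  open FiniteAbelianGroup G using (_∙_; ε; identityˡ; translate)

  uniform : (r g : ℕ) → List (Carrier G)
  uniform r g = r ⊛ [ ε ] ++ g ⊛ nonzero G

  ∑-uniform : ∀ r g F → ∑ (uniform r g) F ≡ r * F ε + g * ∑ (nonzero G) F
  ∑-uniform r g F = begin
    ∑ (uniform r g) F                        ≡⟨ ∑-++ (r ⊛ [ ε ]) (g ⊛ nonzero G) F ⟩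
    _                                        ≡⟨ cong₂ _+_ (∑-⊛ r [ ε ] F) (∑-⊛ g (nonzero G) F) ⟩
    r * (F ε + 0) + g * ∑ (nonzero G) F      ≡⟨ cong (λ a → r * a + g * ∑ (nonzero G) F) (+-identityʳ (F ε)) ⟩
    r * F ε + g * ∑ (nonzero G) F            ∎

  -- This is `translate` with the term of `ε` split off, so that the class of `q` can be treated
  -- apart from the other classes.
  ∑-translate : ∀ q F → F q + ∑ (nonzero G) (λ d → F (d ∙ q)) ≡ ∑ (elements G) F
  ∑-translate q F = begin
    F q + _                                              ≡⟨ cong (λ a → F a + ∑ (nonzero G) (λ d → F (d ∙ q))) (identityˡ q) ⟨
    ∑ (elements G) (λ d → F (d ∙ q))                     ≡⟨ ∑-map (_∙ q) (elements G) F ⟨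
    ∑ (map (_∙ q) (elements G)) F                        ≡⟨ translate q F ⟩
    ∑ (elements G) F                                     ∎

UniformColoring : FiniteAbelianGroup → (r g m n : ℕ) → Set
UniformColoring G r g m n = DiffColoring G m n (uniform G r g)

-- In a uniform colouring only the set of colours matters, not its group structure.
relabel : ∀ {r g} (φ : Carrier G → Carrier H) → map φ (elements G) ≋ elements H →
  UniformColoring G r g m n → UniformColoring H r g m n
relabel {G = G} {H = H} {r = r} {g} φ bij f = record
  { colour = φ ∘ colour f
  ; differences = λ x W → let q = colour f x in begin
      _ ≡⟨ differences f x (W ∘ φ) ⟩
      _ ≡⟨ ∑-uniform G r g _ ⟩
      r * W (φ (G.ε G.∙ q)) + g * ∑ (nonzero G) (λ d → W (φ (d G.∙ q)))
        ≡⟨ cong₂ _+_ (cong (λ a → r * W a) (trans (cong φ (G.identityˡ q)) (sym (H.identityˡ (φ q)))))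
                     (cong (g *_) (others q W)) ⟩
      r * W (H.ε H.∙ φ q) + g * ∑ (nonzero H) (λ d → W (d H.∙ φ q))
        ≡⟨ ∑-uniform H r g _ ⟨
      _ ∎ }
  where
  module G = FiniteAbelianGroup G
  module H = FiniteAbelianGroup H

  others : ∀ q W → ∑ (nonzero G) (λ d → W (φ (d G.∙ q))) ≡ ∑ (nonzero H) (λ d → W (d H.∙ φ q))
  others q W = +-cancelˡ-≡ (W (φ q)) _ _ (begin
    W (φ q) + _                        ≡⟨ ∑-translate G q (W ∘ φ) ⟩
    ∑ (elements G) (W ∘ φ)             ≡⟨ ∑-map φ (elements G) W ⟨
    ∑ (map φ (elements G)) W           ≡⟨ bij W ⟩
    ∑ (elements H) W                   ≡⟨ ∑-translate H (φ q) W ⟨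
    W (φ q) + _                        ∎)

length-cartesianProduct : (xs : List A) (ys : List B) →
  length (cartesianProduct xs ys) ≡ length xs * length ys
length-cartesianProduct []       ys = refl
length-cartesianProduct (x ∷ xs) ys =
  trans (length-++ (map (x ,_) ys)) (cong₂ _+_ (length-map (x ,_) ys) (length-cartesianProduct xs ys))

length-elements : ∀ k → length (elements (F₄^ k)) ≡ 4 ^ k
length-elements zero    = refl
length-elements (suc k) = begin
  length (cartesianProduct allℤ₄ (elements (F₄^ k))) ≡⟨ length-cartesianProduct allℤ₄ (elements (F₄^ k)) ⟩
  4 * length (elements (F₄^ k))                      ≡⟨ cong (4 *_) (length-elements k) ⟩
  4 * 4 ^ k                                          ∎

-- Layers made of punctured lines over F₄.

infixr 8 _·[_]_

_·[_]_ : ℤ₄ → ∀ k → Carrier (F₄^ k) → Carrier (F₄^ k)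
x ·[ zero  ] u       = tt
x ·[ suc k ] (v , u) = x ⊗ v , x ·[ k ] u

·-distribʳ : ∀ k (x y : ℤ₄) (u : Carrier (F₄^ k)) → let open FiniteAbelianGroup (F₄^ k) in
  (x ⊕ y) ·[ k ] u ≡ (x ·[ k ] u) ∙ (y ·[ k ] u)
·-distribʳ zero    x y u       = refl
·-distribʳ (suc k) x y (v , u) = cong₂ _,_ (⊗-distribʳ x y v) (·-distribʳ k x y u)
  where
  ⊗-distribʳ : ∀ x y v → (x ⊕ y) ⊗ v ≡ x ⊗ v ⊕ y ⊗ v
  ⊗-distribʳ = from-yes (all? λ x → all? λ y → all? λ v → (x ⊕ y) ⊗ v ≟ x ⊗ v ⊕ y ⊗ v)

-- `suc x` runs through the nonzero scalars, and multiplication by an invertible scalar permutes the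
-- vectors.
·-≋ : ∀ k (x : Fin 3) → map (suc x ·[ k ]_) (elements (F₄^ k)) ≋ elements (F₄^ k)
·-≋ zero    x F = refl
·-≋ (suc k) x F = begin
  _ ≡⟨ ∑-map (suc x ·[ suc k ]_) (elements (F₄^ (suc k))) F ⟩
  _ ≡⟨ ∑-cartesianProduct allℤ₄ (elements (F₄^ k)) _ ⟩
  ∑ allℤ₄ (λ v → ∑ (elements (F₄^ k)) (λ u → F (suc x ⊗ v , suc x ·[ k ] u)))
    ≡⟨ ∑-cong allℤ₄ (λ v → trans (sym (∑-map (suc x ·[ k ]_) (elements (F₄^ k)) (λ u → F (suc x ⊗ v , u))))
                                 (·-≋ k x (λ u → F (suc x ⊗ v , u)))) ⟩
  ∑ allℤ₄ (λ v → ∑ (elements (F₄^ k)) (λ u → F (suc x ⊗ v , u)))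
    ≡⟨ trans (sym (∑-map (suc x ⊗_) allℤ₄ S)) (⊗-≋ x S) ⟩
  ∑ allℤ₄ S
    ≡⟨ ∑-cartesianProduct allℤ₄ (elements (F₄^ k)) F ⟨
  _ ∎
  where
  S : ℤ₄ → ℕ
  S v = ∑ (elements (F₄^ k)) (λ u → F (v , u))

  counts : ∀ (x : Fin 3) a → ∑ (map (suc x ⊗_) allℤ₄) (λ y → iv (eqF y a)) ≡ ∑ allℤ₄ (λ y → iv (eqF y a))
  counts = from-yes (all? λ x → all? λ a →
    ∑ (map (suc x ⊗_) allℤ₄) (λ y → iv (eqF y a)) ℕ.≟ ∑ allℤ₄ (λ y → iv (eqF y a)))

  ⊗-≋ : (x : Fin 3) → map (suc x ⊗_) allℤ₄ ≋ allℤ₄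
  ⊗-≋ x = ≋-by-count allℤ₄ eqF enumℤ₄ (map (suc x ⊗_) allℤ₄) allℤ₄ (counts x)

scale : ∀ k → Carrier (F₄^ k) → F₄⁺ ⟶ F₄^ k
scale k u = record { ⟦_⟧ = _·[ k ] u ; homo = λ x y → ·-distribʳ k x y u }

identity : G ⟶ G
identity = record { ⟦_⟧ = id ; homo = λ _ _ → refl }

parity : ℤ₄ → ℤ₄
parity 0F = 0F
parity 1F = 1F
parity 2F = 0F
parity 3F = 1F

-- Reduction mod 2 followed by the identification of (p, q) with ωp + q. On `conn` it takes each
-- nonzero value exactly twice, so a Shrikhande coordinate can replace two K₄ coordinates.
β : Z₄² ⟶ F₄⁺
β = record { ⟦_⟧ = β′ ; homo = β′-homo }
  where
  β′ : SVert → ℤ₄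
  β′ (p , q) = 2F ⊗ parity p ⊕ parity q

  β′-homo : ∀ s t → β′ (s ⊞ t) ≡ β′ s ⊕ β′ t
  β′-homo = from-yes (allS? λ s → allS? λ t → β′ (s ⊞ t) ≟ β′ s ⊕ β′ t)

∑-⊛-++ : (r : ℕ) (M L : List A) (F : A → ℕ) → ∑ (r ⊛ M ++ L) F ≡ r * ∑ M F + ∑ L F
∑-⊛-++ r M L F = trans (∑-++ (r ⊛ M) L F) (cong (_+ ∑ L F) (∑-⊛ r M F))

line : ∀ k → Carrier (F₄^ k) → F₄⁺ ⟶ F₄^ (suc k)
line k u = ⟨ identity , scale k u ⟩

lineMoves : ∀ k → Carrier (F₄^ k) → List (Carrier (F₄^ (suc k)))
lineMoves k u = map ⟦ line k u ⟧ units

-- A K₄ coordinate covers the punctured line once and a Shrikhande coordinate, entering through `β`,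
-- covers it twice; hence the multiplicity `2 * s + t`.
addLine : ∀ k s t (u : Carrier (F₄^ k)) {L} → DiffColoring (F₄^ (suc k)) m n L →
  DiffColoring (F₄^ (suc k)) (s + m) (t + n) ((2 * s + t) ⊛ lineMoves k u ++ L)
addLine k zero zero u f = f
addLine k zero (suc t) u {L} f = ≋-resp
  (λ F → begin
    ∑ (lineMoves k u ++ (t ⊛ lineMoves k u ++ L)) F             ≡⟨ ∑-++ (lineMoves k u) (t ⊛ lineMoves k u ++ L) F ⟩
    ∑ (lineMoves k u) F + ∑ (t ⊛ lineMoves k u ++ L) F          ≡⟨ cong (∑ (lineMoves k u) F +_) (∑-⊛-++ t (lineMoves k u) L F) ⟩
    ∑ (lineMoves k u) F + (t * ∑ (lineMoves k u) F + ∑ L F)     ≡⟨ +-assoc (∑ (lineMoves k u) F) _ _ ⟨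
    suc t * ∑ (lineMoves k u) F + ∑ L F                       ≡⟨ ∑-⊛-++ (suc t) (lineMoves k u) L F ⟨
    ∑ (suc t ⊛ lineMoves k u ++ L) F                          ∎)
  (addK₄ (line k u) (addLine k zero t u f))
addLine k (suc s) t u {L} f = ≋-resp
  (λ F → begin
    ∑ (map ⟦ line k u ∘ʰ β ⟧ conn ++ ((2 * s + t) ⊛ lineMoves k u ++ L)) F
      ≡⟨ ∑-++ (map ⟦ line k u ∘ʰ β ⟧ conn) ((2 * s + t) ⊛ lineMoves k u ++ L) F ⟩
    ∑ (map ⟦ line k u ∘ʰ β ⟧ conn) F + ∑ ((2 * s + t) ⊛ lineMoves k u ++ L) F
      ≡⟨ cong₂ _+_ (double (F (⟦ line k u ⟧ 1F)) (F (⟦ line k u ⟧ 2F)) (F (⟦ line k u ⟧ 3F)))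
                   (∑-⊛-++ (2 * s + t) (lineMoves k u) L F) ⟩
    2 * ∑ (lineMoves k u) F + ((2 * s + t) * ∑ (lineMoves k u) F + ∑ L F)
      ≡⟨ collect s t (∑ (lineMoves k u) F) (∑ L F) ⟩
    (2 * suc s + t) * ∑ (lineMoves k u) F + ∑ L F
      ≡⟨ ∑-⊛-++ (2 * suc s + t) (lineMoves k u) L F ⟨
    ∑ ((2 * suc s + t) ⊛ lineMoves k u ++ L) F ∎)
  (addSh (line k u ∘ʰ β) (addLine k s t u f))
  where
  double : ∀ a b c → a + (a + (b + (b + (c + (c + 0))))) ≡ 2 * (a + (b + (c + 0)))
  double = solve-∀

  collect : ∀ s t a b → 2 * a + ((2 * s + t) * a + b) ≡ (2 * suc s + t) * a + b
  collect = solve-∀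

-- Distributes coordinates over `suc N` lines of weight `g` each. The first line takes as many
-- Shrikhande coordinates as it can, up to `h`, and is completed by K₄ coordinates; the bound on `s`
-- is inherited by the other `N` lines.
split : ∀ g h N s t → 2 * h ≤ g → s ≤ h * suc N → 2 * s + t ≡ g * suc N →
  ∃ λ s₁ → ∃ λ s₂ → ∃ λ t₁ → ∃ λ t₂ →
    s₁ + s₂ ≡ s × t₁ + t₂ ≡ t × 2 * s₁ + t₁ ≡ g × s₂ ≤ h * N × 2 * s₂ + t₂ ≡ g * N
split g h N s t 2h≤g s≤ eq = s₁ , s₂ , t₁ , t₂ , s₁+s₂≡s , t₁+t₂≡t , eq₁ , s₂≤hN , eq₂
  where
  s₁ = s ⊓ h
  s₂ = s ∸ h
  t₁ = g ∸ 2 * s₁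
  t₂ = g * N ∸ 2 * s₂

  s₁+s₂≡s : s₁ + s₂ ≡ s
  s₁+s₂≡s = trans (+-comm s₁ s₂) (trans (cong (s₂ +_) (⊓-comm s h)) (trans (+-comm s₂ _) (m⊓n+n∸m≡n h s)))

  s₂≤hN : s₂ ≤ h * N
  s₂≤hN = ≤-trans (∸-monoˡ-≤ h s≤) (≤-reflexive (trans (cong (_∸ h) (*-suc h N)) (m+n∸m≡n h (h * N))))

  eq₁ : 2 * s₁ + t₁ ≡ g
  eq₁ = m+[n∸m]≡n (≤-trans (*-monoʳ-≤ 2 (m⊓n≤n s h)) 2h≤g)

  eq₂ : 2 * s₂ + t₂ ≡ g * N
  eq₂ = m+[n∸m]≡n (≤-trans (*-monoʳ-≤ 2 s₂≤hN) (≤-trans (≤-reflexive (sym (*-assoc 2 h N))) (*-monoˡ-≤ N 2h≤g)))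

  t₁+t₂≡t : t₁ + t₂ ≡ t
  t₁+t₂≡t = +-cancelˡ-≡ (2 * s) _ _ (begin
    2 * s + (t₁ + t₂)             ≡⟨ cong (λ a → 2 * a + (t₁ + t₂)) s₁+s₂≡s ⟨
    2 * (s₁ + s₂) + (t₁ + t₂)     ≡⟨ regroup s₁ s₂ t₁ t₂ ⟩
    2 * s₁ + t₁ + (2 * s₂ + t₂)   ≡⟨ cong₂ _+_ eq₁ eq₂ ⟩
    g + g * N                     ≡⟨ *-suc g N ⟨
    g * suc N                     ≡⟨ eq ⟨
    2 * s + t                     ∎)
    where
    regroup : ∀ a b c d → 2 * (a + b) + (c + d) ≡ 2 * a + c + (2 * b + d)
    regroup = solve-∀

module _ (g h : ℕ) (2h≤g : 2 * h ≤ g) where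

  addLines : ∀ k (us : List (Carrier (F₄^ k))) s t {L} → s ≤ h * length us → 2 * s + t ≡ g * length us →
    DiffColoring (F₄^ (suc k)) m n L →
    DiffColoring (F₄^ (suc k)) (s + m) (t + n) (g ⊛ concatMap (lineMoves k) us ++ L)
  addLines k [] s t {L} s≤ eq f rewrite *-zeroʳ h | *-zeroʳ g
    with refl ← n≤0⇒n≡0 s≤ | refl ← eq =
    ≋-resp (λ F → trans (sym (cong (_+ ∑ L F) (*-zeroʳ g))) (sym (∑-⊛-++ g [] L F))) f
  addLines {m} {n} k (u ∷ us) s t {L} s≤ eq f
    with s₁ , s₂ , t₁ , t₂ , refl , refl , eq₁ , s₂≤ , eq₂ ← split g h (length us) s t 2h≤g s≤ eq =
    ≋-resp
      (λ F → let M = lineMoves k u ; Ms = concatMap (lineMoves k) us in begin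
        ∑ ((2 * s₁ + t₁) ⊛ M ++ (g ⊛ Ms ++ L)) F
          ≡⟨ ∑-⊛-++ (2 * s₁ + t₁) M (g ⊛ Ms ++ L) F ⟩
        (2 * s₁ + t₁) * ∑ M F + ∑ (g ⊛ Ms ++ L) F
          ≡⟨ cong₂ _+_ (cong (_* ∑ M F) eq₁) (∑-⊛-++ g Ms L F) ⟩
        g * ∑ M F + (g * ∑ Ms F + ∑ L F)
          ≡⟨ factor g (∑ M F) (∑ Ms F) (∑ L F) ⟩
        g * (∑ M F + ∑ Ms F) + ∑ L F
          ≡⟨ cong (λ a → g * a + ∑ L F) (∑-++ M Ms F) ⟨
        g * ∑ (M ++ Ms) F + ∑ L F
          ≡⟨ ∑-⊛-++ g (M ++ Ms) L F ⟨
        ∑ (g ⊛ (M ++ Ms) ++ L) F ∎)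
      (subst₂ (λ a b → DiffColoring (F₄^ (suc k)) a b
                         ((2 * s₁ + t₁) ⊛ lineMoves k u ++ (g ⊛ concatMap (lineMoves k) us ++ L)))
        (sym (+-assoc s₁ s₂ m)) (sym (+-assoc t₁ t₂ n))
        (addLine k s₁ t₁ u (addLines k us s₂ t₂ s₂≤ eq₂ f)))
    where
    factor : ∀ g a b c → g * a + (g * b + c) ≡ g * (a + b) + c
    factor = solve-∀

  -- The embedding `ι` places the old differences in 0 × F₄^k, and the punctured lines, each covered
  -- `g` times, supply its complement.
  layerF₄ : ∀ r k s t → s ≤ h * 4 ^ k → 2 * s + t ≡ g * 4 ^ k →
    UniformColoring (F₄^ k) r g m n → UniformColoring (F₄^ (suc k)) r g (s + m) (t + n)
  layerF₄ r k s t s≤ eq f = ≋-resp sums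
    (addLines k E s t (subst (λ a → s ≤ h * a) (sym (length-elements k)) s≤)
                    (trans eq (cong (g *_) (sym (length-elements k)))) (push ι f))
    where
    E = elements (F₄^ k)

    ι : F₄^ k ⟶ F₄^ (suc k)
    ι = record { ⟦_⟧ = 0F ,_ ; homo = λ _ _ → refl }

    lines : ∀ F → ∑ (concatMap (lineMoves k) E) F ≡ ∑ (cartesianProduct units E) F
    lines F = begin
      _ ≡⟨ ∑-concatMap (lineMoves k) E F ⟩
      ∑ E (λ u → ∑ units (λ x → F (x , x ·[ k ] u)))  ≡⟨ ∑-swap E units (λ u x → F (x , x ·[ k ] u)) ⟩
      ∑ units (λ x → ∑ E (λ u → F (x , x ·[ k ] u)))  ≡⟨⟩
      -- For a fixed nonzero scalar x the multiples x u run through all vectors together with u.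
      -- Hence the points (x, x u) of the punctured lines are all pairs with nonzero first entry,
      -- once each.
      ∑ (allFin 3) (λ x → ∑ E (λ u → F (suc x , suc x ·[ k ] u)))
        ≡⟨ ∑-cong (allFin 3) (λ x → trans (sym (∑-map (suc x ·[ k ]_) E _)) (·-≋ k x (λ u → F (suc x , u)))) ⟩
      ∑ units (λ x → ∑ E (λ u → F (x , u)))      ≡⟨ ∑-cartesianProduct units E F ⟨
      _ ∎

    sums : g ⊛ concatMap (lineMoves k) E ++ map ⟦ ι ⟧ (uniform (F₄^ k) r g) ≋ uniform (F₄^ (suc k)) r g
    sums F = let N = nonzero (F₄^ k) in begin
      _ ≡⟨ ∑-⊛-++ g (concatMap (lineMoves k) E) _ F ⟩
      _ ≡⟨ cong₂ (λ a b → g * a + b) (lines F)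
             (trans (∑-map ⟦ ι ⟧ (uniform (F₄^ k) r g) F) (∑-uniform (F₄^ k) r g _)) ⟩
      g * ∑ (cartesianProduct units E) F + (r * F (FiniteAbelianGroup.ε (F₄^ (suc k))) + g * ∑ N (λ u → F (0F , u)))
        ≡⟨ rearrange g (∑ (cartesianProduct units E) F) (r * F _) (∑ N (λ u → F (0F , u))) ⟩
      r * F (FiniteAbelianGroup.ε (F₄^ (suc k))) + g * (∑ N (λ u → F (0F , u)) + ∑ (cartesianProduct units E) F)
        ≡⟨ cong (λ a → r * F _ + g * a) (trans (∑-++ (map (0F ,_) N) (cartesianProduct units E) F)
             (cong (_+ ∑ (cartesianProduct units E) F) (∑-map (0F ,_) N F))) ⟨
      r * F (FiniteAbelianGroup.ε (F₄^ (suc k))) + g * ∑ (nonzero (F₄^ (suc k))) F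
        ≡⟨ ∑-uniform (F₄^ (suc k)) r g F ⟨
      _ ∎
      where
      rearrange : ∀ g a b c → g * a + (b + g * c) ≡ b + g * (c + a)
      rearrange = solve-∀

-- Layers made of Shrikhande coordinates over ℤ₄².

∑-cong-All : {F G : A → ℕ} {xs : List A} → All (λ x → F x ≡ G x) xs → ∑ xs F ≡ ∑ xs G
∑-cong-All []         = refl
∑-cong-All (eq ∷ eqs) = cong₂ _+_ eq (∑-cong-All eqs)

addShs : {L : List (Carrier G)} (hs : List (Z₄² ⟶ G)) → DiffColoring G m n L →
  DiffColoring G (length hs + m) n (concatMap (λ h → map ⟦ h ⟧ conn) hs ++ L)
addShs         []       f = f
addShs {L = L} (h ∷ hs) f = ≋-resp
  (λ F → cong (λ M → ∑ M F) (sym (++-assoc (map ⟦ h ⟧ conn) (concatMap (λ h → map ⟦ h ⟧ conn) hs) L)))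
  (addSh h (addShs hs f))

-- The map (p, q) ↦ (p + q, 2q - p) has determinant 3, a unit mod 4. It carries `conn` to ±(1,2),
-- ±(1,3), ±(2,1), the elements of order 4 outside `conn`.
τ : Z₄² ⟶ Z₄²
τ = record { ⟦_⟧ = τ′ ; homo = from-yes (allS? λ s → allS? λ t → ≡-dec _≟_ _≟_ (τ′ (s ⊞ t)) (τ′ s ⊞ τ′ t)) }
  where
  τ′ : SVert → SVert
  τ′ (p , q) = p ⊞₁ q , p ⊞₁ p ⊞₁ p ⊞₁ q ⊞₁ q

-- Identifies F₄ with the subgroup 2ℤ₄²; it takes `⟦ β ⟧ s` to `s ⊞ s`.
double : F₄⁺ ⟶ Z₄²
double = record { ⟦_⟧ = d ; homo = from-yes (all? λ x → all? λ y → ≡-dec _≟_ _≟_ (d (x ⊕ y)) (d x ⊞ d y)) }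
  where
  d : ℤ₄ → SVert
  d 0F = 0F , 0F
  d 1F = 0F , 2F
  d 2F = 2F , 0F
  d 3F = 2F , 2F

-- The elements of order 4 of ℤ₄² split into the connection set and its image under τ.
Z₄²-partition : map ⟦ double ⟧ units ++ conn ++ map ⟦ τ ⟧ conn ≋ nonzero Z₄²
Z₄²-partition = ≋-by-count allSVert eqS enumSVert parts (nonzero Z₄²) counts
  where
  parts : List SVert
  parts = map ⟦ double ⟧ units ++ conn ++ map ⟦ τ ⟧ conn

  counts : ∀ a → ∑ parts (λ z → iv (eqS z a)) ≡ ∑ (nonzero Z₄²) (λ z → iv (eqS z a))
  counts = from-yes (allS? λ a →
    ∑ parts (λ z → iv (eqS z a)) ℕ.≟ ∑ (nonzero Z₄²) (λ z → iv (eqS z a)))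

twists : ∀ k → List (Z₄² ⟶ (Z₄² ⊠ F₄^ k))
twists k = map (λ (A , u) → ⟨ A , scale k u ∘ʰ β ⟩) (cartesianProduct (identity ∷ τ ∷ []) (elements (F₄^ k)))

length-twists : ∀ k → length (twists k) ≡ 2 * 4 ^ k
length-twists k = trans (length-map _ (cartesianProduct (identity ∷ τ ∷ []) (elements (F₄^ k))))
  (trans (length-cartesianProduct (identity ∷ τ ∷ []) (elements (F₄^ k))) (cong (2 *_) (length-elements k)))

-- For δ in `conn` the scalar `⟦ β ⟧ δ` is nonzero, so its multiples of u run through F₄^k together
-- with u. The twists over `identity` and over `τ` thus fill the whole fibre above each element of
-- order 4.
∑-twists : ∀ k F → ∑ (twists k) (λ h → ∑ (map ⟦ h ⟧ conn) F) ≡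
  ∑ (conn ++ map ⟦ τ ⟧ conn) (λ z → ∑ (elements (F₄^ k)) (λ u → F (z , u)))
∑-twists k F = begin
  _ ≡⟨ ∑-map _ (cartesianProduct (identity ∷ τ ∷ []) E) _ ⟩
  _ ≡⟨ ∑-cartesianProduct (identity ∷ τ ∷ []) E _ ⟩
  _ ≡⟨ ∑-cong (identity ∷ τ ∷ []) orbit ⟩
  ∑ conn S + (∑ conn (S ∘ ⟦ τ ⟧) + 0) ≡⟨ cong (∑ conn S +_) (+-identityʳ _) ⟩
  ∑ conn S + ∑ conn (S ∘ ⟦ τ ⟧)       ≡⟨ cong (∑ conn S +_) (∑-map ⟦ τ ⟧ conn S) ⟨
  ∑ conn S + ∑ (map ⟦ τ ⟧ conn) S     ≡⟨ ∑-++ conn (map ⟦ τ ⟧ conn) S ⟨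
  ∑ (conn ++ map ⟦ τ ⟧ conn) S        ∎
  where
  E = elements (F₄^ k)

  S : SVert → ℕ
  S z = ∑ E (λ u → F (z , u))

  rescale : ∀ z (x : Fin 3) → ∑ E (λ u → F (z , suc x ·[ k ] u)) ≡ S z
  rescale z x = trans (sym (∑-map (suc x ·[ k ]_) E (λ u → F (z , u)))) (·-≋ k x (λ u → F (z , u)))

  orbit : (A : Z₄² ⟶ Z₄²) →
    ∑ E (λ u → ∑ (map ⟦ ⟨ A , scale k u ∘ʰ β ⟩ ⟧ conn) F) ≡ ∑ conn (S ∘ ⟦ A ⟧)
  orbit A = begin
    _ ≡⟨ ∑-cong E (λ u → ∑-map ⟦ ⟨ A , scale k u ∘ʰ β ⟩ ⟧ conn F) ⟩
    _ ≡⟨ ∑-swap E conn (λ u δ → F (⟦ A ⟧ δ , ⟦ β ⟧ δ ·[ k ] u)) ⟩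
    ∑ conn (λ δ → ∑ E (λ u → F (⟦ A ⟧ δ , ⟦ β ⟧ δ ·[ k ] u)))
      -- In the order of `conn` the values of `β` are 1, 1, ω, ω, ω², ω², which are `suc 0F`,
      -- `suc 1F` and `suc 2F`, each twice.
      ≡⟨ ∑-cong-All {F = λ δ → ∑ E (λ u → F (⟦ A ⟧ δ , ⟦ β ⟧ δ ·[ k ] u))} {G = S ∘ ⟦ A ⟧}
           (rescale _ 0F ∷ rescale _ 0F ∷ rescale _ 1F ∷ rescale _ 1F ∷ rescale _ 2F ∷ rescale _ 2F ∷ []) ⟩
    ∑ conn (S ∘ ⟦ A ⟧) ∎

-- The embedding `ι` places the old differences in 2ℤ₄² × F₄^k, and `g` copies of the twists supply
-- the complement. The resulting group is not isomorphic to F₄^(k+2), but `relabel` needs only the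
-- bijection `φ` to continue with the latter.
layerZ₄ : ∀ r g k → UniformColoring (F₄^ (suc k)) r g m n →
  UniformColoring (F₄^ (suc (suc k))) r g (g * (2 * 4 ^ k) + m) n
layerZ₄ {m} {n} r g k f = subst (λ a → UniformColoring (F₄^ (suc (suc k))) r g (a + m) n)
  (trans (length-⊛ g (twists k)) (cong (g *_) (length-twists k)))
  (relabel {r = r} {g} φ φ-bij (≋-resp sums (addShs (g ⊛ twists k) (push ι f))))
  where
  E = elements (F₄^ k)
  N = nonzero (F₄^ k)

  ι : F₄^ (suc k) ⟶ (Z₄² ⊠ F₄^ k)
  ι = record { ⟦_⟧ = λ (v , u) → ⟦ double ⟧ v , u
             ; homo = λ (v , u) (v′ , u′) → cong (_, FiniteAbelianGroup._∙_ (F₄^ k) u u′) (homo double v v′) }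

  φ : SVert × Carrier (F₄^ k) → Carrier (F₄^ (suc (suc k)))
  φ ((a , b) , u) = a , b , u

  φ-bij : map φ (elements (Z₄² ⊠ F₄^ k)) ≋ elements (F₄^ (suc (suc k)))
  φ-bij F = begin
    _ ≡⟨ ∑-map φ (cartesianProduct (cartesianProduct allℤ₄ allℤ₄) E) F ⟩
    _ ≡⟨ ∑-cartesianProduct (cartesianProduct allℤ₄ allℤ₄) E (F ∘ φ) ⟩
    _ ≡⟨ ∑-cartesianProduct allℤ₄ allℤ₄ (λ (a , b) → ∑ E (λ u → F (a , b , u))) ⟩
    _ ≡⟨ ∑-cong allℤ₄ (λ a → ∑-cartesianProduct allℤ₄ E (λ (b , u) → F (a , b , u))) ⟨
    _ ≡⟨ ∑-cartesianProduct allℤ₄ (cartesianProduct allℤ₄ E) F ⟨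
    _ ∎

  sums : concatMap (λ h → map ⟦ h ⟧ conn) (g ⊛ twists k) ++ map ⟦ ι ⟧ (uniform (F₄^ (suc k)) r g) ≋
         uniform (Z₄² ⊠ F₄^ k) r g
  sums F = begin
    _ ≡⟨ ∑-++ (concatMap (λ h → map ⟦ h ⟧ conn) (g ⊛ twists k)) (map ⟦ ι ⟧ (uniform (F₄^ (suc k)) r g)) F ⟩
    _ ≡⟨ cong₂ _+_ new old ⟩
    g * ∑ Odd S + (r * F₀ + g * (∑ N F₁ + ∑ units (S ∘ ⟦ double ⟧)))
      ≡⟨ rearrange g r (∑ Odd S) F₀ (∑ N F₁) (∑ units (S ∘ ⟦ double ⟧)) ⟩
    r * F₀ + g * (∑ N F₁ + (∑ units (S ∘ ⟦ double ⟧) + ∑ Odd S))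
      ≡⟨ cong (λ a → r * F₀ + g * (∑ N F₁ + a)) partition ⟩
    r * F₀ + g * (∑ N F₁ + ∑ (nonzero Z₄²) S)
      ≡⟨ cong (λ a → r * F₀ + g * a) (nonzero-⊠ Z₄² F) ⟨
    r * F₀ + g * ∑ (nonzero (Z₄² ⊠ F₄^ k)) F
      ≡⟨ ∑-uniform (Z₄² ⊠ F₄^ k) r g F ⟨
    _ ∎
    where
    Odd = conn ++ map ⟦ τ ⟧ conn

    F₀ : ℕ
    F₀ = F (FiniteAbelianGroup.ε (Z₄² ⊠ F₄^ k))

    F₁ : Carrier (F₄^ k) → ℕ
    F₁ u = F (FiniteAbelianGroup.ε Z₄² , u)

    S : SVert → ℕ
    S z = ∑ E (λ u → F (z , u))

    nonzero-⊠ : ∀ G F → ∑ (nonzero (G ⊠ F₄^ k)) F ≡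
      ∑ N (λ u → F (FiniteAbelianGroup.ε G , u)) + ∑ (nonzero G) (λ v → ∑ E (λ u → F (v , u)))
    nonzero-⊠ G F = trans (∑-++ (map _ N) (cartesianProduct (nonzero G) E) F)
      (cong₂ _+_ (∑-map _ N F) (∑-cartesianProduct (nonzero G) E F))

    new : ∑ (concatMap (λ h → map ⟦ h ⟧ conn) (g ⊛ twists k)) F ≡ g * ∑ Odd S
    new = begin
      _                                                 ≡⟨ ∑-concatMap (λ h → map ⟦ h ⟧ conn) (g ⊛ twists k) F ⟩
      _                                                 ≡⟨ ∑-⊛ g (twists k) _ ⟩
      g * ∑ (twists k) (λ h → ∑ (map ⟦ h ⟧ conn) F)     ≡⟨ cong (g *_) (∑-twists k F) ⟩
      g * ∑ Odd S                                       ∎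

    old : ∑ (map ⟦ ι ⟧ (uniform (F₄^ (suc k)) r g)) F ≡
          r * F₀ + g * (∑ N F₁ + ∑ units (S ∘ ⟦ double ⟧))
    old = begin
      _ ≡⟨ ∑-map ⟦ ι ⟧ (uniform (F₄^ (suc k)) r g) F ⟩
      _ ≡⟨ ∑-uniform (F₄^ (suc k)) r g (F ∘ ⟦ ι ⟧) ⟩
      _ ≡⟨ cong (λ a → r * F₀ + g * a) (nonzero-⊠ F₄⁺ (F ∘ ⟦ ι ⟧)) ⟩
      _ ∎

    partition : ∑ units (S ∘ ⟦ double ⟧) + ∑ Odd S ≡ ∑ (nonzero Z₄²) S
    partition = begin
      _ ≡⟨ cong (_+ ∑ Odd S) (∑-map ⟦ double ⟧ units S) ⟨
      _ ≡⟨ ∑-++ (map ⟦ double ⟧ units) Odd S ⟨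
      _ ≡⟨ Z₄²-partition S ⟩
      _ ∎

    rearrange : ∀ g r a b c d → g * a + (r * b + g * (c + d)) ≡ r * b + g * (c + (d + a))
    rearrange = solve-∀

-- The non-additive colouring of D(2,0).

half : ℤ₄ → ℤ₄
half 0F = 0F
half 1F = 0F
half 2F = 1F
half 3F = 1F

-- The list `3 ⊛ allℤ₄` is invariant under translation as a multiset, so it suffices to find three
-- neighbours of each colour at every vertex, a finite check.
equitable : DiffColoring F₄⁺ 2 0 (3 ⊛ allℤ₄)
equitable = record
  { colour = c
  ; differences = λ { (s ∷ t ∷ [] , []) W → let x = s ∷ t ∷ [] , [] in begin
      ∑ (neighbours x) (W ∘ c)        ≡⟨ ∑-map c (neighbours x) W ⟨
      ∑ (map c (neighbours x)) W      ≡⟨ ≋-by-count allℤ₄ eqF enumℤ₄ (map c (neighbours x)) (3 ⊛ allℤ₄) (counts s t) W ⟩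
      ∑ (3 ⊛ allℤ₄) W                 ≡⟨ ∑-⊛ 3 allℤ₄ W ⟩
      3 * ∑ allℤ₄ W                   ≡⟨ cong (3 *_) (FiniteAbelianGroup.translate F₄⁺ (c x) W) ⟨
      3 * ∑ (map (_⊕ c x) allℤ₄) W    ≡⟨ cong (3 *_) (∑-map (_⊕ c x) allℤ₄ W) ⟩
      3 * ∑ allℤ₄ (λ d → W (d ⊕ c x)) ≡⟨ ∑-⊛ 3 allℤ₄ (λ d → W (d ⊕ c x)) ⟨
      _                               ∎ } }
  where
  -- As ±1-functions, the two bits of c and their sum are each a product of a 2-eigenfunction of one
  -- Shrikhande factor and a (−2)-eigenfunction of the other, hence 0-eigenfunctions of D(2,0).
  c : DVert 2 0 → ℤ₄
  c ((p , q) ∷ (p′ , q′) ∷ [] , []) = half p ⊕ parity q′ ⊕ 2F ⊗ (parity p ⊕ half p′)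

  counts : ∀ s t a → let x = s ∷ t ∷ [] , [] in
    ∑ (map c (neighbours x)) (λ d → iv (eqF d a)) ≡ ∑ (3 ⊛ allℤ₄) (λ d → iv (eqF d a))
  counts = from-yes (allS? λ s → allS? λ t → all? λ a →
    ∑ (map c (neighbours (s ∷ t ∷ [] , []))) (λ d → iv (eqF d a)) ℕ.≟ ∑ (3 ⊛ allℤ₄) (λ d → iv (eqF d a)))

-- Existence of uniform colourings for all admissible parameters.

-- (4 ^ k − 1) / 3
repunit : ℕ → ℕ
repunit zero    = 0
repunit (suc k) = 4 ^ k + repunit k

3*repunit : ∀ k → suc (3 * repunit k) ≡ 4 ^ k
3*repunit zero    = refl
3*repunit (suc k) = trans (shuffle (4 ^ k) (repunit k)) (trans (cong (3 * 4 ^ k +_) (3*repunit k)) (close (4 ^ k)))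
  where
  shuffle : ∀ a b → suc (3 * (a + b)) ≡ 3 * a + suc (3 * b)
  shuffle = solve-∀

  close : ∀ a → 3 * a + a ≡ 4 * a
  close = solve-∀

constant : ∀ g → UniformColoring (F₄^ 0) 0 g 0 0
constant g = record
  { colour = λ _ → tt
  ; differences = λ { ([] , []) W → sym (trans (∑-uniform (F₄^ 0) 0 g (λ _ → W tt)) (*-zeroʳ g)) } }

recombine : ∀ {s m′ m t n′ n A B} → s + m′ ≡ m → 2 * s + t ≡ A → 2 * m′ + n′ ≡ B → 2 * m + n ≡ A + B →
  t + n′ ≡ n
recombine {s} {m′} {t = t} {n′} refl refl refl eq = sym (+-cancelˡ-≡ (2 * (s + m′)) _ _ (trans eq (shuffle s m′ t n′)))
  where
  shuffle : ∀ s m t n → 2 * s + t + (2 * m + n) ≡ 2 * (s + m) + (t + n)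
  shuffle = solve-∀

-- If more Shrikhande coordinates remain than one layer of `layerF₄` and the colouring below it can
-- absorb, then g is odd and there are enough of them to fill a layer of `layerZ₄`.
excess : ∀ g h k m n → 1 ≤ h → g ≡ 2 * h ⊎ g ≡ suc (2 * h) → 2 * m + n ≡ g * repunit (suc k) →
  ¬ 2 * (m ∸ h * 4 ^ k) ≤ g * repunit k → g ≡ suc (2 * h) × g * 4 ^ k ≤ 2 * m
-- For even `g` the top layer can consist of Shrikhande coordinates alone, since 2h = g; what is
-- left of 2m is then at most `g * repunit k`.
excess g h k m n 1≤h (inj₁ refl) eq 2m′≰ = contradiction
  (≤-trans (≤-reflexive (trans (*-distribˡ-∸ 2 m (h * Q)) (cong (2 * m ∸_) (sym (*-assoc 2 h Q)))))
    (m≤n+o⇒m∸n≤o (2 * m) (g * Q)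
      (≤-trans (m≤m+n (2 * m) n) (≤-reflexive (trans eq (*-distribˡ-+ g Q (repunit k)))))))
  2m′≰
  where Q = 4 ^ k
excess g h k m n 1≤h (inj₂ refl) eq 2m′≰ = refl , ≤-trans (≤-reflexive (split-odd h Q))
    ([ (λ 2m≤2hQ → contradiction (≤-trans (m≤m+n 1 _) Q≤) (subst (λ a → ¬ 1 ≤ a) (sym (m≤n⇒m∸n≡0 2m≤2hQ)) λ ()))
     , (λ 2hQ≤2m → ≤-trans (+-monoˡ-≤ (2 * (h * Q)) (≤-trans (≤-reflexive (sym (3*repunit k))) Q≤)) (≤-reflexive (m∸n+n≡m 2hQ≤2m)))
     ]′ (≤-total (2 * m) (2 * (h * Q))))
  where
  Q = 4 ^ k

  split-odd : ∀ h Q → suc (2 * h) * Q ≡ Q + 2 * (h * Q)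
  split-odd = solve-∀

  -- By `1≤h` the odd `g` is at least 3, so exceeding `g * repunit k` means reaching
  -- `suc (3 * repunit k)`, which is `4 ^ k`. Together with 2h times `4 ^ k` this makes `g * 4 ^ k`.
  Q≤ : suc (3 * repunit k) ≤ 2 * m ∸ 2 * (h * Q)
  Q≤ = ≤-trans (s≤s (*-monoˡ-≤ (repunit k) (s≤s (*-monoʳ-≤ 2 1≤h))))
         (≤-trans (≰⇒> 2m′≰) (≤-reflexive (*-distribˡ-∸ 2 m (h * Q))))

-- Induction on `k`. The top layer over F₄ takes up to `h * 4 ^ k` Shrikhande coordinates; if the
-- remaining ones fit below, the recursion applies. Otherwise `excess` provides enough of them for a
-- top layer over ℤ₄².
colorings : ∀ g h → 1 ≤ h → g ≡ 2 * h ⊎ g ≡ suc (2 * h) → ∀ k m n → 2 * m + n ≡ g * repunit k →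
  UniformColoring (F₄^ k) 0 g m n
colorings g h 1≤h parity zero zero n eq
  with refl ← trans eq (*-zeroʳ g) = constant g
colorings g h 1≤h parity zero (suc m) n eq with () ← trans eq (*-zeroʳ g)
colorings g h 1≤h parity (suc k) m n eq with 2 * (m ∸ h * 4 ^ k) ≤? g * repunit k
... | yes 2m′≤ = subst₂ (UniformColoring (F₄^ (suc k)) 0 g) s+m′≡m
        (recombine {s} {m ∸ h * Q} s+m′≡m t-eq n′-eq eq′)
        (layerF₄ g h 2h≤g 0 k s (g * Q ∸ 2 * s) (m⊓n≤n m (h * Q)) t-eq
          (colorings g h 1≤h parity k (m ∸ h * Q) (g * repunit k ∸ 2 * (m ∸ h * Q)) n′-eq))
  where
  Q = 4 ^ k
  s = m ⊓ (h * Q)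

  s+m′≡m : s + (m ∸ h * Q) ≡ m
  s+m′≡m = trans (cong (_+ (m ∸ h * Q)) (⊓-comm m (h * Q))) (m⊓n+n∸m≡n (h * Q) m)

  2h≤g : 2 * h ≤ g
  2h≤g = [ ≤-reflexive ∘ sym , (λ e → ≤-trans (n≤1+n _) (≤-reflexive (sym e))) ]′ parity

  t-eq : 2 * s + (g * Q ∸ 2 * s) ≡ g * Q
  t-eq = m+[n∸m]≡n (≤-trans (*-monoʳ-≤ 2 (m⊓n≤n m (h * Q)))
           (≤-trans (≤-reflexive (sym (*-assoc 2 h Q))) (*-monoˡ-≤ Q 2h≤g)))

  n′-eq : 2 * (m ∸ h * Q) + (g * repunit k ∸ 2 * (m ∸ h * Q)) ≡ g * repunit k
  n′-eq = m+[n∸m]≡n 2m′≤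

  eq′ : 2 * m + n ≡ g * Q + g * repunit k
  eq′ = trans eq (*-distribˡ-+ g Q (repunit k))
... | no 2m′≰ with excess g h k m n 1≤h parity eq 2m′≰
...   | refl , gQ≤2m = onlyShrikhande k gQ≤2m eq
  where
  onlyShrikhande : ∀ k → g * 4 ^ k ≤ 2 * m → 2 * m + n ≡ g * repunit (suc k) →
    UniformColoring (F₄^ (suc k)) 0 g m n
  -- A layer over ℤ₄² needs a factor 4 underneath. At the bottom 2m would be squeezed to equal `g`,
  -- which is odd here.
  onlyShrikhande zero gQ≤2m eq = contradiction
    (≤-antisym (≤-trans (m≤m+n (2 * m) n) (≤-reflexive (trans eq (*-identityʳ g))))
               (≤-trans (≤-reflexive (sym (*-identityʳ g))) gQ≤2m))
    (even≢odd m h)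
  onlyShrikhande (suc j) gQ≤2m eq = subst (λ a → UniformColoring (F₄^ (suc (suc j))) 0 g a n) S+m′≡m
    (layerZ₄ 0 g j (colorings g h 1≤h parity (suc j) (m ∸ S) n
      (+-cancelˡ-≡ (2 * S) _ _ (begin
        2 * S + (2 * (m ∸ S) + n)          ≡⟨ collect S (m ∸ S) n ⟩
        2 * (S + (m ∸ S)) + n              ≡⟨ cong (λ a → 2 * a + n) S+m′≡m ⟩
        2 * m + n                          ≡⟨ eq ⟩
        g * (4 ^ suc j + repunit (suc j))  ≡⟨ *-distribˡ-+ g (4 ^ suc j) _ ⟩
        g * 4 ^ suc j + g * repunit (suc j) ≡⟨ cong (_+ g * repunit (suc j)) (quadruple g (4 ^ j)) ⟨
        2 * S + g * repunit (suc j)        ∎))))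
    where
    S = g * (2 * 4 ^ j)

    quadruple : ∀ g a → 2 * (g * (2 * a)) ≡ g * (4 * a)
    quadruple = solve-∀

    collect : ∀ a b n → 2 * a + (2 * b + n) ≡ 2 * (a + b) + n
    collect = solve-∀

    S+m′≡m : S + (m ∸ S) ≡ m
    S+m′≡m = m+[n∸m]≡n {S} {m} (*-cancelˡ-≤ 2 (≤-trans (≤-reflexive (quadruple g (4 ^ j))) gQ≤2m))

-- The colouring `equitable` has each of the four differences three times. Adding `h` Shrikhande
-- coordinates on the only line of F₄ raises the nonzero multiplicities to 2h + 3 = g and leaves
-- that of 0 at 3; `layerZ₄` preserves this shape and adds no K₄ coordinate.
shrikhandeColoring : ∀ h k → let g = suc (2 * suc h) in
  ∃ λ m → 2 * m ≡ suc (g * repunit (suc k)) × UniformColoring (F₄^ (suc k)) 3 g m 0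
shrikhandeColoring h zero = h + 2 , size h , ≋-resp sums (addLine 0 h 0 tt (push ι equitable))
  where
  size : ∀ h → 2 * (h + 2) ≡ suc (suc (2 * suc h) * 1)
  size = solve-∀

  ι : F₄⁺ ⟶ F₄^ 1
  ι = record { ⟦_⟧ = _, tt ; homo = λ _ _ → refl }

  sums : (2 * h + 0) ⊛ lineMoves 0 tt ++ map ⟦ ι ⟧ (3 ⊛ allℤ₄) ≋ uniform (F₄^ 1) 3 (suc (2 * suc h))
  sums F = trans (∑-⊛-++ (2 * h + 0) (lineMoves 0 tt) (map ⟦ ι ⟧ (3 ⊛ allℤ₄)) F)
    (trans (cong ((2 * h + 0) * ∑ (lineMoves 0 tt) F +_) (trans (∑-map ⟦ ι ⟧ (3 ⊛ allℤ₄) F) (∑-⊛ 3 allℤ₄ (F ∘ ⟦ ι ⟧))))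
    (trans (collect h (F (0F , tt)) (F (1F , tt)) (F (2F , tt)) (F (3F , tt)))
           (sym (∑-uniform (F₄^ 1) 3 (suc (2 * suc h)) F))))
    where
    collect : ∀ h a b c d → (2 * h + 0) * (b + (c + (d + 0))) + 3 * (a + (b + (c + (d + 0)))) ≡
                            3 * a + suc (2 * suc h) * (b + (c + (d + 0)))
    collect = solve-∀
shrikhandeColoring h (suc k) =
  let m , eq , f = shrikhandeColoring h k
      g = suc (2 * suc h)
  in g * (2 * 4 ^ k) + m , trans (*-distribˡ-+ 2 (g * (2 * 4 ^ k)) m)
       (trans (cong (2 * (g * (2 * 4 ^ k)) +_) eq) (collect g (4 ^ k) (repunit (suc k)))) , layerZ₄ 3 g k f
  where
  collect : ∀ g a b → 2 * (g * (2 * a)) + suc (g * b) ≡ suc (g * (4 * a + b))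
  collect = solve-∀

-- Merging the colour classes into two.

-- The block of size `M` is filled from `b` first, and from `c` only when `b` is exhausted. Three
-- uses distribute prescribed class sizes over the four cosets of F₄^k in F₄^(k+1).
divide : ∀ b c M N → b + c ≡ M + N → ∃ λ b₁ → ∃ λ c₁ → ∃ λ b₂ → ∃ λ c₂ →
  b₁ + c₁ ≡ M × b₂ + c₂ ≡ N × b₁ + b₂ ≡ b × c₁ + c₂ ≡ c
divide b c M N eq with ≤-total b M
... | inj₁ b≤M = b , M ∸ b , 0 , N , m+[n∸m]≡n b≤M , refl , +-identityʳ b ,
  +-cancelˡ-≡ b _ _ (trans (sym (+-assoc b (M ∸ b) N)) (trans (cong (_+ N) (m+[n∸m]≡n b≤M)) (sym eq)))
... | inj₂ M≤b = M , 0 , b ∸ M , c , +-identityʳ M ,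
  +-cancelˡ-≡ M _ _ (trans (sym (+-assoc M (b ∸ M) c)) (trans (cong (_+ c) (m+[n∸m]≡n M≤b)) eq)) ,
  m+[n∸m]≡n M≤b , refl

classSize : ∀ k → (Carrier (F₄^ k) → Fin 2) → Fin 2 → ℕ
classSize k χ j = ∑ (elements (F₄^ k)) (λ q → iv ⌊ χ q ≟ j ⌋)

twoColoring : ∀ k b c → b + c ≡ 4 ^ k → ∃ λ χ → classSize k χ 0F ≡ b × classSize k χ 1F ≡ c
twoColoring zero zero          c    refl = (λ _ → 1F) , refl , refl
twoColoring zero (suc zero)    zero refl = (λ _ → 0F) , refl , refl
twoColoring zero (suc (suc b)) c    ()
twoColoring (suc k) b c eq
  with b₀ , c₀ , b′  , c′  , eq₀ , eq′ , refl , refl ← divide b c (4 ^ k) (3 * 4 ^ k) eq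
  with b₁ , c₁ , b″  , c″  , eq₁ , eq″ , refl , refl ← divide b′ c′ (4 ^ k) (2 * 4 ^ k) eq′
  with b₂ , c₂ , b₃  , c₃  , eq₂ , eq₃ , refl , refl ← divide b″ c″ (4 ^ k) (1 * 4 ^ k) eq″
  with χ₀ , refl , refl ← twoColoring k b₀ c₀ eq₀
     | χ₁ , refl , refl ← twoColoring k b₁ c₁ eq₁
     | χ₂ , refl , refl ← twoColoring k b₂ c₂ eq₂
     | χ₃ , refl , refl ← twoColoring k b₃ c₃ (trans eq₃ (+-identityʳ (4 ^ k)))
  = χ , size 0F , size 1F
  where
  χ : Carrier (F₄^ (suc k)) → Fin 2
  χ (0F , q) = χ₀ q
  χ (1F , q) = χ₁ q
  χ (2F , q) = χ₂ q
  χ (3F , q) = χ₃ q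

  size : ∀ j → classSize (suc k) χ j ≡
    classSize k χ₀ j + (classSize k χ₁ j + (classSize k χ₂ j + classSize k χ₃ j))
  size j = trans (∑-cartesianProduct allℤ₄ (elements (F₄^ k)) _)
    (cong (λ a → classSize k χ₀ j + (classSize k χ₁ j + (classSize k χ₂ j + a))) (+-identityʳ _))

∑-positive : (P : A → Bool) (xs : List A) → 1 ≤ ∑ xs (iv ∘ P) → ∃ λ x → P x ≡ true
∑-positive P (x ∷ xs) 1≤ with P x in eq
... | true  = x , eq
... | false = ∑-positive P xs 1≤

-- There is at least one vertex, and it has a neighbour of the opposite colour.
surjective : (f : Coloring m n) → DVert m n → (∀ x → f x ≡ 0F → 1 ≤ nbrsOfColor f x 1F) →
  (∀ x → f x ≡ 1F → 1 ≤ nbrsOfColor f x 0F) → Surjective f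
surjective f x₀ to-1 to-0 = attained (f x₀) refl
  where
  neighbour : ∀ x j → 1 ≤ nbrsOfColor f x j → ∃ λ y → f y ≡ j
  neighbour x j 1≤ with y , eq ← ∑-positive (λ y → ⌊ f y ≟ j ⌋) (neighbours x) (subst (1 ≤_) (nbrsOfColor-∑ f x j) 1≤)
    with f y ≟ j
  ... | yes fy≡j = y , fy≡j
  ... | no _ with () ← eq

  attained : ∀ i → f x₀ ≡ i → ∀ j → ∃ λ y → f y ≡ j
  attained 0F eq 0F = x₀ , eq
  attained 0F eq 1F = neighbour x₀ 1F (to-1 x₀ eq)
  attained 1F eq 0F = neighbour x₀ 0F (to-0 x₀ eq)
  attained 1F eq 1F = x₀ , eq

module _ (r g b c k : ℕ) (1≤g : 1 ≤ g) (1≤b : 1 ≤ b) (1≤c : 1 ≤ c) (b+c : b + c ≡ 4 ^ k)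
         (f : UniformColoring (F₄^ k) r g m n) where

  -- Here `b` and `c` stand for the quotients by `g` of the entries of the final matrix. Colour `0F`
  -- receives `c` classes and colour `1F` receives `b`; a vertex has `g` neighbours in every class
  -- but its own, and `r` in its own.
  merge : HasPerfectColoring m n (mat2 (c * g ∸ g + r) (b * g) (c * g) (b * g ∸ g + r))
  merge = φ , surjective φ x₀ (λ x eq → positive x 1F (subst (λ i → S i 1F ≡ b * g) (sym eq) refl) 1≤b)
                              (λ x eq → positive x 0F (subst (λ i → S i 0F ≡ c * g) (sym eq) refl) 1≤c)
            , λ x j → count x j
    where
    S = mat2 (c * g ∸ g + r) (b * g) (c * g) (b * g ∸ g + r)

    classes : ∃ λ χ → classSize k χ 0F ≡ c × classSize k χ 1F ≡ b
    classes = twoColoring k c b (trans (+-comm c b) b+c)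

    χ = proj₁ classes

    φ : Coloring m n
    φ x = χ (colour f x)

    x₀ : DVert m n
    x₀ = Vec.replicate m (0F , 0F) , Vec.replicate n 0F

    δ : Fin 2 → Fin 2 → ℕ
    δ i j = iv ⌊ i ≟ j ⌋

    -- Adding `g` fictitious neighbours in the vertex's own class lets all classes count `g` times,
    -- apart from the `r` extra neighbours; subtraction is deferred to `same`.
    balance : ∀ x j → nbrsOfColor φ x j + g * δ (φ x) j ≡ r * δ (φ x) j + g * classSize k χ j
    balance x j = let open FiniteAbelianGroup (F₄^ k) using (_∙_; ε; identityˡ) ; q = colour f x
                      W = λ p → δ (χ p) j ; T = ∑ (nonzero (F₄^ k)) (λ d → W (d ∙ q)) in begin
      nbrsOfColor φ x j + g * W q            ≡⟨ cong (_+ g * W q) (nbrsOfColor-∑ φ x j) ⟩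
      ∑ (neighbours x) (W ∘ colour f) + g * W q ≡⟨ cong (_+ g * W q) (differences f x W) ⟩
      _                                      ≡⟨ cong (_+ g * W q) (∑-uniform (F₄^ k) r g (λ d → W (d ∙ q))) ⟩
      r * W (ε ∙ q) + g * T + g * W q        ≡⟨ cong (λ a → r * W a + g * T + g * W q) (identityˡ q) ⟩
      r * W q + g * T + g * W q              ≡⟨ collect r g (W q) T ⟩
      r * W q + g * (W q + T)                ≡⟨ cong (λ a → r * W q + g * a) (∑-translate (F₄^ k) q W) ⟩
      r * W q + g * classSize k χ j          ∎
      where
      collect : ∀ r g w t → r * w + g * t + g * w ≡ r * w + g * (w + t)
      collect = solve-∀

    same : ∀ {N s T} → T ≡ s → 1 ≤ s → N + g * 1 ≡ r * 1 + g * T → N ≡ s * g ∸ g + r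
    -- The vertex's own colour comprises at least one class, so the truncated difference
    -- `suc s * g ∸ g` is an exact one.
    same {N} {suc s} refl _ eq = trans
      (+-cancelʳ-≡ g N (s * g + r) (trans (cong (N +_) (sym (*-identityʳ g))) (trans eq (shift r g s))))
      (cong (_+ r) (sym (m+n∸m≡n g (s * g))))
      where
      shift : ∀ r g s → r * 1 + g * suc s ≡ s * g + r + g
      shift = solve-∀

    different : ∀ {N s T} → T ≡ s → N + g * 0 ≡ r * 0 + g * T → N ≡ s * g
    different {N} {s} refl eq = trans (sym (+-identityʳ N)) (trans (cong (N +_) (sym (*-zeroʳ g)))
      (trans eq (trans (cong (_+ g * s) (*-zeroʳ r)) (*-comm g s))))

    count : ∀ x j → nbrsOfColor φ x j ≡ S (φ x) j
    count x j with φ x | balance x j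
    count x 0F | 0F | eq = same (proj₁ (proj₂ classes)) 1≤c eq
    count x 1F | 0F | eq = different (proj₂ (proj₂ classes)) eq
    count x 0F | 1F | eq = different (proj₁ (proj₂ classes)) eq
    count x 1F | 1F | eq = same (proj₂ (proj₂ classes)) 1≤b eq

    positive : ∀ x j {s} → S (φ x) j ≡ s * g → 1 ≤ s → 1 ≤ nbrsOfColor φ x j
    positive x j eq 1≤s = subst (1 ≤_) (sym (trans (count x j) eq)) (*-mono-≤ 1≤s 1≤g)

-- Assembly of the two statements.

halve : ∀ g → 2 ≤ g → ∃ λ h → g ≡ 2 * suc h ⊎ g ≡ suc (2 * suc h)
halve (suc zero)                (s≤s ())
halve (suc (suc zero))          _ = 0 , inj₁ refl
halve (suc (suc (suc zero)))    _ = 0 , inj₂ refl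
halve (suc (suc (suc (suc g)))) _ with halve (suc (suc g)) (s≤s (s≤s z≤n))
... | h , inj₁ eq = suc h , inj₁ (trans (cong (2 +_) eq) (sym (*-suc 2 (suc h))))
... | h , inj₂ eq = suc h , inj₂ (trans (cong (2 +_) eq) (cong suc (sym (*-suc 2 (suc h)))))

4^-repunit : ∀ l → 4 ^ l ∸ 1 ≡ 3 * repunit l
4^-repunit l = cong (_∸ 1) (sym (3*repunit l))

theorem4 : ∀ (b c l : ℕ) → 1 ≤ b → 1 ≤ c → 1 ≤ l → 2 ≤ gcd b c →
    b + c ≡ gcd b c * 4 ^ l →
    (∀ (m n : ℕ) → 3 * (2 * m + n) ≡ gcd b c * (4 ^ l ∸ 1) →
    HasPerfectColoring m n (mat2 (c ∸ gcd b c) b c (b ∸ gcd b c)))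
    × (gcd b c % 2 ≡ 1 → ∀ (m : ℕ) → 3 * (2 * m) ≡ gcd b c * (4 ^ l ∸ 1) + 3 →
    HasPerfectColoring m 0 (mat2 (c ∸ gcd b c + 3) b c (b ∸ gcd b c + 3)))
theorem4 b c (suc k) 1≤b 1≤c _ 2≤g b+c = part₁ (gcd b c) (gcd[m,n]∣m b c) (gcd[m,n]∣n b c) 2≤g b+c
                                       , part₂ (gcd b c) (gcd[m,n]∣m b c) (gcd[m,n]∣n b c) 2≤g b+c
  where
  l = suc k

  -- With a variable `g` in place of `gcd b c`, the divisibility equations for `b` and `c` can be
  -- matched with `refl`.
  mergeAt : ∀ {r m n} g b′ c′ → 2 ≤ g → b ≡ b′ * g → c ≡ c′ * g → b + c ≡ g * 4 ^ l →
    UniformColoring (F₄^ l) r g m n → HasPerfectColoring m n (mat2 (c ∸ g + r) b c (b ∸ g + r))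
  mergeAt {r} {m} {n} g@(suc _) b′ c′ 2≤g refl refl eq f =
    merge r g b′ c′ l (s≤s z≤n) (quotient 1≤b) (quotient 1≤c)
      (*-cancelʳ-≡ (b′ + c′) (4 ^ l) g
        (trans (*-distribʳ-+ g b′ c′) (trans eq (*-comm g (4 ^ l))))) f
    where
    quotient : ∀ {q} → 1 ≤ q * g → 1 ≤ q
    quotient {suc q} _ = s≤s z≤n

  scaled : ∀ g → g * (4 ^ l ∸ 1) ≡ 3 * (g * repunit l)
  scaled g = trans (cong (g *_) (4^-repunit l)) (swap g (repunit l))
    where
    swap : ∀ g a → g * (3 * a) ≡ 3 * (g * a)
    swap = solve-∀

  part₁ : ∀ g → g ∣ b → g ∣ c → 2 ≤ g → b + c ≡ g * 4 ^ l → ∀ m n → 3 * (2 * m + n) ≡ g * (4 ^ l ∸ 1) →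
    HasPerfectColoring m n (mat2 (c ∸ g) b c (b ∸ g))
  part₁ g (divides b′ b≡) (divides c′ c≡) 2≤g b+c m n eq with h , parity ← halve g 2≤g =
    subst₂ (λ s t → HasPerfectColoring m n (mat2 s b c t)) (+-identityʳ (c ∸ g)) (+-identityʳ (b ∸ g))
      (mergeAt g b′ c′ 2≤g b≡ c≡ b+c
        (colorings g (suc h) (s≤s z≤n) parity l m n
          (*-cancelˡ-≡ (2 * m + n) (g * repunit l) 3 (trans eq (scaled g)))))

  part₂ : ∀ g → g ∣ b → g ∣ c → 2 ≤ g → b + c ≡ g * 4 ^ l → g % 2 ≡ 1 → ∀ m → 3 * (2 * m) ≡ g * (4 ^ l ∸ 1) + 3 →
    HasPerfectColoring m 0 (mat2 (c ∸ g + 3) b c (b ∸ g + 3))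
  part₂ g (divides b′ b≡) (divides c′ c≡) 2≤g b+c odd m eq with halve g 2≤g
  ... | h , inj₁ refl with () ← trans (sym odd) (trans (cong (_% 2) (*-comm 2 (suc h))) (m*n%n≡0 (suc h) 2))
  ... | h , inj₂ refl with m′ , eq′ , f ← shrikhandeColoring h k =
    mergeAt g b′ c′ 2≤g b≡ c≡ b+c
      (subst (λ a → UniformColoring (F₄^ l) 3 g a 0) (*-cancelˡ-≡ m′ m 2 (trans eq′ (sym size))) f)
    where
    size : 2 * m ≡ suc (g * repunit l)
    size = *-cancelˡ-≡ (2 * m) (suc (g * repunit l)) 3
      (trans eq (trans (cong (_+ 3) (scaled g)) (trans (+-comm _ 3) (sym (*-suc 3 (g * repunit l))))))
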